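{- Let $\mathcal{M}$ be a simple regular matroid of rank $r>0$ on $n$ elements and let $M\in\mathbb{Z}^{r\times n}$ be a full-rank weakly unimodular representation of $\mathcal{M}$. Then the facets of $\mathcal{P}_M$ are exactly the faces $F_{\mathbf{u}}$, for $\mathbf{u}\in\mathcal{P}_M^{\Delta}\cap\mathbb{Z}^r$, for which $M^T\mathbf{u}$ is a spanning $2$-cut of $M$.
   Context: A matrix $M\in\mathbb{Z}^{r\times n}$ with $0<r\le n$ is full-rank weakly unimodular if it has rank $r$ and every $r\times r$ minor lies in $\{0,\pm1\}$; it represents the matroid on $[n]$ whose independent sets are the sets of linearly independent columns. $\mathcal{P}_M\subseteq\mathbb{R}^r$ is the convex hull of the columns of $[M\mid -M]$, and $\mathcal{P}_M^{\Delta}=\{\mathbf{u}:\mathbf{u}\cdot\mathbf{x}\le1\ \forall\mathbf{x}\in\mathcal{P}_M\}$ is its polar. For $\mathbf{u}\in\mathcal{P}_M^{\Delta}\cap\mathbb{Z}^r$, $F_{\mathbf{u}}=\mathrm{conv}\{\mathbf{v}:\mathbf{v}\text{ a vertex of }\mathcal{P}_M,\ \mathbf{v}\cdot\mathbf{u}=1\}$. $\Gamma(M)=\mathrm{row}(M)\cap\mathbb{Z}^n$; a $2$-cut of $M$ is an element of $\Gamma(M)$ with entries in $\{0,\pm1\}$. A cut $\boldsymbol{\gamma}$ is spanning if its support $\{i:\gamma_i\ne0\}$ contains a basis of $\mathcal{M}$.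
   Formalization: The polytope P_M, its polar condition, its faces and supporting hyperplanes, and linear independence and row space are taken over the rationals (in ℚ^r) instead of the reals (in ℝ^r). -}

module Defs where

open import Data.Nat as ℕ using (ℕ; zero; suc)
open import Data.Fin using (Fin; zero; suc)
open import Data.Integer as ℤ using (ℤ)
open import Data.Rational as ℚ using (ℚ; 0ℚ; 1ℚ)
open import Data.Product using (Σ; ∃; _×_; _,_)
open import Data.Sum using (_⊎_)
open import Relation.Nullary using (¬_)
open import Relation.Binary.PropositionalEquality using (_≡_; _≢_)

Σℤ : ∀ {m} → (Fin m → ℤ) → ℤ
Σℤ {zero}  f = ℤ.+ 0
Σℤ {suc m} f = f zero ℤ.+ Σℤ (λ i → f (suc i))

Σℚ : ∀ {m} → (Fin m → ℚ) → ℚ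
Σℚ {zero}  f = 0ℚ
Σℚ {suc m} f = f zero ℚ.+ Σℚ (λ i → f (suc i))

ι : ℤ → ℚ
ι z = z ℚ./ 1

Mat : ℕ → ℕ → Set
Mat r n = Fin r → Fin n → ℤ

Pt : ℕ → Set
Pt r = Fin r → ℚ

_≈_ : ∀ {r} → Pt r → Pt r → Set
x ≈ y = ∀ a → x a ≡ y a

dot : ∀ {r} → Pt r → Pt r → ℚ
dot x y = Σℚ (λ a → x a ℚ.* y a)

col : ∀ {r n} → Mat r n → Fin n → Pt r
col M i a = ι (M a i)

transp· : ∀ {r n} → Mat r n → (Fin r → ℤ) → (Fin n → ℤ)
transp· M u i = Σℤ (λ a → M a i ℤ.* u a)

LinIndep : ∀ {r k} → (Fin k → Pt r) → Set
LinIndep {r} {k} v =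
  (c : Fin k → ℚ) → ((a : Fin r) → Σℚ (λ j → c j ℚ.* v j a) ≡ 0ℚ) →
  (j : Fin k) → c j ≡ 0ℚ

sgn : ℕ → ℤ
sgn zero    = ℤ.+ 1
sgn (suc k) = ℤ.- sgn k

det : ∀ k → (Fin k → Fin k → ℤ) → ℤ
det zero    A = ℤ.+ 1
det (suc k) A =
  Σℤ (λ j → sgn (Data.Fin.toℕ j) ℤ.* (A zero j ℤ.* det k (λ a b → A (suc a) (Data.Fin.punchIn j b))))

minor : ∀ {r n} → Mat r n → (Fin r → Fin n) → ℤ
minor {r} M σ = det r (λ a j → M a (σ j))

HasFullRowRank : ∀ {r n} → Mat r n → Set
HasFullRowRank {r} {n} M = Σ (Fin r → Fin n) (λ σ → LinIndep (λ j → col M (σ j)))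

IsFullRankWU : ∀ {r n} → Mat r n → Set
IsFullRankWU {r} {n} M =
  HasFullRowRank M ×
  ((σ : Fin r → Fin n) →
     (minor M σ ≡ ℤ.+ 0) ⊎ (minor M σ ≡ ℤ.+ 1) ⊎ (minor M σ ≡ ℤ.- (ℤ.+ 1)))

IndepCols : ∀ {r n} → Mat r n → (Fin n → Set) → Set
IndepCols {r} {n} M S =
  (c : Fin n → ℚ) → ((i : Fin n) → ¬ S i → c i ≡ 0ℚ) →
  ((a : Fin r) → Σℚ (λ i → c i ℚ.* col M i a) ≡ 0ℚ) →
  (i : Fin n) → c i ≡ 0ℚ

-- simple matroid: no loops and no parallel elements, i.e. every set of
-- at most two elements is independent
IsSimple : ∀ {r n} → Mat r n → Set
IsSimple {r} {n} M = (i j : Fin n) → IndepCols M (λ k → (k ≡ i) ⊎ (k ≡ j))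

IsBasis : ∀ {r n} → Mat r n → (Fin n → Set) → Set
IsBasis {r} {n} M B =
  IndepCols M B × ((i : Fin n) → ¬ B i → ¬ IndepCols M (λ k → B k ⊎ (k ≡ i)))

InΓ : ∀ {r n} → Mat r n → (Fin n → ℤ) → Set
InΓ {r} {n} M γ = Σ (Pt r) (λ y → (i : Fin n) → Σℚ (λ a → y a ℚ.* col M i a) ≡ ι (γ i))

Is2Cut : ∀ {r n} → Mat r n → (Fin n → ℤ) → Set
Is2Cut {r} {n} M γ =
  InΓ M γ × ((i : Fin n) → (γ i ≡ ℤ.+ 0) ⊎ (γ i ≡ ℤ.+ 1) ⊎ (γ i ≡ ℤ.- (ℤ.+ 1)))

IsSpanning : ∀ {r n} → Mat r n → (Fin n → ℤ) → Set₁
IsSpanning {r} {n} M γ =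
  Σ (Fin n → Set) (λ B → IsBasis M B × ((i : Fin n) → B i → γ i ≢ ℤ.+ 0))

IsSpanning2Cut : ∀ {r n} → Mat r n → (Fin n → ℤ) → Set₁
IsSpanning2Cut M γ = Is2Cut M γ × IsSpanning M γ

Conv : ∀ {r} → (Pt r → Set) → Pt r → Set
Conv {r} V x =
  Σ ℕ (λ k → Σ (Fin k → Pt r) (λ p → Σ (Fin k → ℚ) (λ λ' →
    ((j : Fin k) → V (p j)) ×
    ((j : Fin k) → 0ℚ ℚ.≤ λ' j) ×
    (Σℚ λ' ≡ 1ℚ) ×
    ((a : Fin r) → x a ≡ Σℚ (λ j → λ' j ℚ.* p j a)))))

PM : ∀ {r n} → Mat r n → Pt r → Set
PM {r} {n} M = Conv (λ v → ∃ λ (i : Fin n) → (v ≈ col M i) ⊎ (v ≈ (λ a → ℚ.- col M i a)))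

InPolar : ∀ {r n} → Mat r n → (Fin r → ℤ) → Set
InPolar {r} M u = (x : Pt r) → PM M x → dot (λ a → ι (u a)) x ℚ.≤ 1ℚ

_≐_ : ∀ {r} → (Pt r → Set) → (Pt r → Set) → Set
F ≐ G = ∀ x → (F x → G x) × (G x → F x)

IsFace : ∀ {r} → (Pt r → Set) → (Pt r → Set) → Set
IsFace {r} P F =
  Σ (Pt r) (λ c → Σ ℚ (λ b →
    ((x : Pt r) → P x → dot c x ℚ.≤ b) ×
    (F ≐ (λ x → P x × (dot c x ≡ b)))))

IsVertex : ∀ {r} → (Pt r → Set) → Pt r → Set
IsVertex P v = IsFace P (λ x → x ≈ v)

AffIndep : ∀ {r k} → (Fin (suc k) → Pt r) → Set
AffIndep p = LinIndep (λ j a → p (suc j) a ℚ.- p zero a)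

HasDim : ∀ {r} → (Pt r → Set) → ℕ → Set
HasDim {r} F d =
  Σ (Fin (suc d) → Pt r) (λ p → ((j : Fin (suc d)) → F (p j)) × AffIndep p) ×
  ¬ Σ (Fin (suc (suc d)) → Pt r) (λ p → ((j : Fin (suc (suc d))) → F (p j)) × AffIndep p)

IsFacet : ∀ {r} → (Pt r → Set) → (Pt r → Set) → Set
IsFacet {r} P F = IsFace P F × HasDim F (r ℕ.∸ 1)

Fu : ∀ {r n} → Mat r n → (Fin r → ℤ) → Pt r → Set
Fu {r} M u = Conv (λ v → IsVertex (PM M) v × (dot v (λ a → ι (u a)) ≡ 1ℚ))

{-# OPTIONS --safe #-}
-- Cramer's rule makes the dual basis of any basis of columns of M integral, with values in {0, ±1} on
-- all columns.  For a column i, choose for every j ≠ i a basis containing i and j; the sum of the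
-- corresponding coordinate functionals of i is uniquely maximal at column i among all ± columns.
-- Hence every ± column is a vertex of the polytope, and F_u is the face where u attains the value 1.
-- A facet has the form u · x = 1 with the columns satisfying u · M_i = ±1 spanning ℚ^r; a basis among
-- them shows that u is integral, and so |u · M_i| ≤ 1 makes Mᵀu a spanning 2-cut.  Conversely, a
-- basis in the support of the cut gives r affinely independent points of F_u.
module Submission where

open import Defs
open import Data.Nat as ℕ using (ℕ; zero; suc)
import Data.Nat.Properties as ℕ
open import Data.Fin using (Fin; zero; suc; toℕ; fromℕ<; punchIn; punchOut)
import Data.Fin.Properties as Fin
open import Data.Integer as ℤ using (ℤ)
import Data.Integer.Properties as ℤ
open import Data.Rational hiding (_≃_; truncate)
open import Data.Rational.Properties
import Data.Rational.Unnormalised as ℚᵘ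
import Data.Rational.Unnormalised.Properties as ℚᵘ
open import Data.Product using (Σ; ∃; _×_; _,_; proj₁; proj₂)
open import Data.Sum using (_⊎_; inj₁; inj₂)
open import Data.Empty using (⊥-elim)
open import Data.Unit using (⊤; tt)
open import Function using (_∘_; case_of_)
open import Relation.Nullary using (¬_; Dec; yes; no)
open import Relation.Nullary.Decidable using (dec⇒maybe; ¬?; _×-dec_; decidable-stable)
open import Relation.Binary.PropositionalEquality
open import Tactic.RingSolver using (solve-∀)
open import Tactic.RingSolver.Core.AlmostCommutativeRing using (AlmostCommutativeRing; fromCommutativeRing)

-- Integrality comes from determinants: the minor of a basis is nonzero, hence ±1, so Cramer's rule
-- divides by a unit. The value of a dual vector on a column is then a minor up to sign, and its
-- entries are integer determinants. In the sum of functionals exposing column i, strictness comes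
-- from a single summand: the i-th is -1 at the negated column i, and the k-th is 0 at both signs of
-- a column k ≠ i. A facet arrives as an arbitrary inequality c · x ≤ b. The polytope contains the
-- origin, so b ≥ 0; by symmetry b = 0 would make the face the whole polytope, of dimension r.
-- Dividing by b puts the face on a hyperplane that misses the origin, where affine and linear
-- independence coincide; this links the dimension of the face to bases of columns. The argument is
-- constructive: extracting a basis needs a decidable set of columns, whereas the basis in the
-- definition of a spanning cut is an arbitrary predicate. The extraction therefore works with the
-- support of the cut, which is decidable.

ℚ-ring : AlmostCommutativeRing _ _
ℚ-ring = fromCommutativeRing +-*-commutativeRing (λ x → dec⇒maybe (0ℚ ≟ x))

private
  variable
    k m n r : ℕ
    A : Set

-- Rational arithmetic

inverse : ∀ {q} → q ≢ 0ℚ → Σ ℚ (λ q⁻¹ → q⁻¹ * q ≡ 1ℚ)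
inverse {q} q≢0 = 1/ q , *-inverseˡ q
  where instance _ = ≢-nonZero q≢0

*-zeroʳ-≡ : ∀ p {q} → q ≡ 0ℚ → p * q ≡ 0ℚ
*-zeroʳ-≡ p refl = *-zeroʳ p

*-zeroˡ-≡ : ∀ {p} q → p ≡ 0ℚ → p * q ≡ 0ℚ
*-zeroˡ-≡ q refl = *-zeroˡ q

*-cancelʳ-≡0 : ∀ {p q} → q ≢ 0ℚ → p * q ≡ 0ℚ → p ≡ 0ℚ
*-cancelʳ-≡0 {p} {q} q≢0 pq≡0 with inverse q≢0
... | q⁻¹ , q⁻¹q≡1 = begin
  p              ≡⟨ sym (*-identityʳ p) ⟩
  p * 1ℚ         ≡⟨ cong (p *_) (sym q⁻¹q≡1) ⟩
  p * (q⁻¹ * q)  ≡⟨ lemma p q⁻¹ q ⟩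
  q⁻¹ * (p * q)  ≡⟨ *-zeroʳ-≡ q⁻¹ pq≡0 ⟩
  0ℚ             ∎
  where
  open ≡-Reasoning
  lemma : ∀ x y z → x * (y * z) ≡ y * (x * z)
  lemma = solve-∀ ℚ-ring

*-nonNeg : ∀ {p q} → 0ℚ ≤ p → 0ℚ ≤ q → 0ℚ ≤ p * q
*-nonNeg {p} {q} 0≤p 0≤q = nonNegative⁻¹ (p * q) {{nonNeg*nonNeg⇒nonNeg p q}}
  where instance
    _ = nonNegative 0≤p
    _ = nonNegative 0≤q

0≤q-p : ∀ {p q} → p ≤ q → 0ℚ ≤ q - p
0≤q-p {p} {q} p≤q = subst (_≤ q - p) (+-inverseʳ p) (+-monoˡ-≤ (- p) p≤q)

p-q≡0⇒p≡q : ∀ {p q} → p - q ≡ 0ℚ → p ≡ q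
p-q≡0⇒p≡q {p} {q} eq = begin
  p            ≡⟨ lemma p q ⟩
  (p - q) + q  ≡⟨ cong (_+ q) eq ⟩
  0ℚ + q       ≡⟨ +-identityˡ q ⟩
  q            ∎
  where
  open ≡-Reasoning
  lemma : ∀ x y → x ≡ (x - y) + y
  lemma = solve-∀ ℚ-ring

≤∧≢⇒< : ∀ {p q} → p ≤ q → p ≢ q → p < q
≤∧≢⇒< p≤q p≢q = ≰⇒> (λ q≤p → p≢q (≤-antisym p≤q q≤p))

0<1 : 0ℚ < 1ℚ
0<1 = positive⁻¹ 1ℚ

-1<1 : - 1ℚ < 1ℚ
-1<1 = neg<pos (- 1ℚ) 1ℚ

neg-involutive : ∀ p → - (- p) ≡ p
neg-involutive = solve-∀ ℚ-ring

-- The embedding of the integers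

ι-toℚᵘ : ∀ z → toℚᵘ (ι z) ℚᵘ.≃ ℚᵘ.mkℚᵘ z 0
ι-toℚᵘ z = toℚᵘ-fromℚᵘ (ℚᵘ.mkℚᵘ z 0)

ι-+ : ∀ x y → ι (x ℤ.+ y) ≡ ι x + ι y
ι-+ x y = toℚᵘ-injective (begin
  toℚᵘ (ι (x ℤ.+ y))                 ≈⟨ ι-toℚᵘ (x ℤ.+ y) ⟩
  ℚᵘ.mkℚᵘ (x ℤ.+ y) 0                ≈⟨ ℚᵘ.*≡* (cong (ℤ._* ℤ.+ 1) (cong₂ ℤ._+_ (sym (ℤ.*-identityʳ x)) (sym (ℤ.*-identityʳ y)))) ⟩
  ℚᵘ.mkℚᵘ x 0 ℚᵘ.+ ℚᵘ.mkℚᵘ y 0       ≈⟨ ℚᵘ.+-cong (ι-toℚᵘ x) (ι-toℚᵘ y) ⟨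
  toℚᵘ (ι x) ℚᵘ.+ toℚᵘ (ι y)         ≈⟨ toℚᵘ-homo-+ (ι x) (ι y) ⟨
  toℚᵘ (ι x + ι y)                   ∎)
  where open ℚᵘ.≃-Reasoning

ι-* : ∀ x y → ι (x ℤ.* y) ≡ ι x * ι y
ι-* x y = toℚᵘ-injective (begin
  toℚᵘ (ι (x ℤ.* y))                 ≈⟨ ι-toℚᵘ (x ℤ.* y) ⟩
  ℚᵘ.mkℚᵘ x 0 ℚᵘ.* ℚᵘ.mkℚᵘ y 0       ≈⟨ ℚᵘ.*-cong (ι-toℚᵘ x) (ι-toℚᵘ y) ⟨
  toℚᵘ (ι x) ℚᵘ.* toℚᵘ (ι y)         ≈⟨ toℚᵘ-homo-* (ι x) (ι y) ⟨
  toℚᵘ (ι x * ι y)                   ∎)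
  where open ℚᵘ.≃-Reasoning

ι-neg : ∀ x → ι (ℤ.- x) ≡ - ι x
ι-neg x = toℚᵘ-injective (begin
  toℚᵘ (ι (ℤ.- x))      ≈⟨ ι-toℚᵘ (ℤ.- x) ⟩
  ℚᵘ.- ℚᵘ.mkℚᵘ x 0      ≈⟨ ℚᵘ.-‿cong (ι-toℚᵘ x) ⟨
  ℚᵘ.- toℚᵘ (ι x)       ≈⟨ toℚᵘ-homo‿- (ι x) ⟨
  toℚᵘ (- ι x)          ∎)
  where open ℚᵘ.≃-Reasoning

ι-injective : ∀ {x y} → ι x ≡ ι y → x ≡ y
ι-injective {x} {y} eq = begin
  x              ≡⟨ sym (ℤ.*-identityʳ x) ⟩
  x ℤ.* ℤ.+ 1    ≡⟨ ℚᵘ.drop-*≡* (ℚᵘ.≃-trans (ℚᵘ.≃-sym (ι-toℚᵘ x)) (ℚᵘ.≃-trans (toℚᵘ-cong eq) (ι-toℚᵘ y))) ⟩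
  y ℤ.* ℤ.+ 1    ≡⟨ ℤ.*-identityʳ y ⟩
  y              ∎
  where open ≡-Reasoning

ι-cancel-≤ : ∀ {x y} → ι x ≤ ι y → x ℤ.≤ y
ι-cancel-≤ {x} {y} le = subst₂ ℤ._≤_ (ℤ.*-identityʳ x) (ℤ.*-identityʳ y)
  (ℚᵘ.drop-*≤* (ℚᵘ.≤-respʳ-≃ (ι-toℚᵘ y) (ℚᵘ.≤-respˡ-≃ (ι-toℚᵘ x) (toℚᵘ-mono-≤ le))))

IsInt : ℚ → Set
IsInt q = ∃ λ z → ι z ≡ q

IsInt-+ : ∀ {p q} → IsInt p → IsInt q → IsInt (p + q)
IsInt-+ (x , refl) (y , refl) = x ℤ.+ y , ι-+ x y

IsInt-* : ∀ {p q} → IsInt p → IsInt q → IsInt (p * q)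
IsInt-* (x , refl) (y , refl) = x ℤ.* y , ι-* x y

Trit : ℚ → Set
Trit q = (q ≡ 0ℚ) ⊎ (q ≡ 1ℚ) ⊎ (q ≡ - 1ℚ)

Tritℤ : ℤ → Set
Tritℤ z = (z ≡ ℤ.+ 0) ⊎ (z ≡ ℤ.+ 1) ⊎ (z ≡ ℤ.- (ℤ.+ 1))

Unit : ℚ → Set
Unit q = (q ≡ 1ℚ) ⊎ (q ≡ - 1ℚ)

Unit? : ∀ q → Dec (Unit q)
Unit? q with q ≟ 1ℚ | q ≟ - 1ℚ
... | yes p | _     = yes (inj₁ p)
... | no _  | yes p = yes (inj₂ p)
... | no p  | no p′ = no λ { (inj₁ e) → p e ; (inj₂ e) → p′ e }

Unit⇒≢0 : ∀ {q} → Unit q → q ≢ 0ℚ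
Unit⇒≢0 (inj₁ refl) ()
Unit⇒≢0 (inj₂ refl) ()

Unit⇒Int : ∀ {q} → Unit q → IsInt q
Unit⇒Int (inj₁ refl) = ℤ.+ 1 , refl
Unit⇒Int (inj₂ refl) = ℤ.- (ℤ.+ 1) , refl

Unit-* : ∀ {q} → Unit q → q * q ≡ 1ℚ
Unit-* (inj₁ refl) = refl
Unit-* (inj₂ refl) = refl

Trit∧≢0⇒Unit : ∀ {q} → Trit q → q ≢ 0ℚ → Unit q
Trit∧≢0⇒Unit (inj₁ q≡0) q≢0 = ⊥-elim (q≢0 q≡0)
Trit∧≢0⇒Unit (inj₂ u)   _   = u

Trit*Unit : ∀ {p q} → Trit p → Unit q → Trit (p * q)
Trit*Unit {q = q} (inj₁ refl) _           = inj₁ (*-zeroˡ q)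
Trit*Unit (inj₂ (inj₁ refl)) (inj₁ refl) = inj₂ (inj₁ refl)
Trit*Unit (inj₂ (inj₁ refl)) (inj₂ refl) = inj₂ (inj₂ refl)
Trit*Unit (inj₂ (inj₂ refl)) (inj₁ refl) = inj₂ (inj₂ refl)
Trit*Unit (inj₂ (inj₂ refl)) (inj₂ refl) = inj₂ (inj₁ refl)

Trit⇒≤1 : ∀ {q} → Trit q → q ≤ 1ℚ
Trit⇒≤1 (inj₁ refl)        = ≤ᵇ⇒≤ _
Trit⇒≤1 (inj₂ (inj₁ refl)) = ≤ᵇ⇒≤ _
Trit⇒≤1 (inj₂ (inj₂ refl)) = ≤ᵇ⇒≤ _

Trit-neg : ∀ {q} → Trit q → Trit (- q)
Trit-neg (inj₁ refl)        = inj₁ refl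
Trit-neg (inj₂ (inj₁ refl)) = inj₂ (inj₂ refl)
Trit-neg (inj₂ (inj₂ refl)) = inj₂ (inj₁ refl)

Tritℤ⇒Trit : ∀ {z} → Tritℤ z → Trit (ι z)
Tritℤ⇒Trit (inj₁ refl)        = inj₁ refl
Tritℤ⇒Trit (inj₂ (inj₁ refl)) = inj₂ (inj₁ refl)
Tritℤ⇒Trit (inj₂ (inj₂ refl)) = inj₂ (inj₂ refl)

∣z∣≤1⇒Tritℤ : ∀ z → ι z ≤ 1ℚ → - ι z ≤ 1ℚ → Tritℤ z
∣z∣≤1⇒Tritℤ z z≤1 -z≤1 = cases z (ι-cancel-≤ z≤1) (ι-cancel-≤ (subst (_≤ 1ℚ) (sym (ι-neg z)) -z≤1))
  where
  cases : ∀ x → x ℤ.≤ ℤ.+ 1 → ℤ.- x ℤ.≤ ℤ.+ 1 → Tritℤ x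
  cases (ℤ.+ 0)           _ _ = inj₁ refl
  cases (ℤ.+ 1)           _ _ = inj₂ (inj₁ refl)
  cases (ℤ.+ suc (suc _)) (ℤ.+≤+ (ℕ.s≤s ())) _
  cases ℤ.-[1+ 0 ]        _ _ = inj₂ (inj₂ refl)
  cases ℤ.-[1+ suc _ ]    _ (ℤ.+≤+ (ℕ.s≤s ()))

-- Finite sums

Σ-cong : {f g : Fin m → ℚ} → (∀ i → f i ≡ g i) → Σℚ f ≡ Σℚ g
Σ-cong {zero}  eq = refl
Σ-cong {suc m} eq = cong₂ _+_ (eq zero) (Σ-cong (eq ∘ suc))

Σ-zero : {f : Fin m → ℚ} → (∀ i → f i ≡ 0ℚ) → Σℚ f ≡ 0ℚ
Σ-zero {zero}  eq = refl
Σ-zero {suc m} eq = cong₂ _+_ (eq zero) (Σ-zero (eq ∘ suc))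

Σ-+ : (f g : Fin m → ℚ) → Σℚ (λ i → f i + g i) ≡ Σℚ f + Σℚ g
Σ-+ {zero}  f g = refl
Σ-+ {suc m} f g = trans (cong (f zero + g zero +_) (Σ-+ (f ∘ suc) (g ∘ suc)))
                        (lemma (f zero) (g zero) (Σℚ (f ∘ suc)) (Σℚ (g ∘ suc)))
  where
  lemma : ∀ a b c d → (a + b) + (c + d) ≡ (a + c) + (b + d)
  lemma = solve-∀ ℚ-ring

Σ-*ˡ : ∀ s (f : Fin m → ℚ) → Σℚ (λ i → s * f i) ≡ s * Σℚ f
Σ-*ˡ {zero}  s f = sym (*-zeroʳ s)
Σ-*ˡ {suc m} s f = trans (cong (s * f zero +_) (Σ-*ˡ s (f ∘ suc)))
                         (sym (*-distribˡ-+ s (f zero) (Σℚ (f ∘ suc))))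

Σ-*ʳ : ∀ s (f : Fin m → ℚ) → Σℚ (λ i → f i * s) ≡ Σℚ f * s
Σ-*ʳ s f = trans (Σ-cong (λ i → *-comm (f i) s)) (trans (Σ-*ˡ s f) (*-comm s (Σℚ f)))

Σ-neg : (f : Fin m → ℚ) → Σℚ (λ i → - f i) ≡ - Σℚ f
Σ-neg {zero}  f = refl
Σ-neg {suc m} f = trans (cong (- f zero +_) (Σ-neg (f ∘ suc))) (sym (neg-distrib-+ (f zero) (Σℚ (f ∘ suc))))

Σ-- : (f g : Fin m → ℚ) → Σℚ (λ i → f i - g i) ≡ Σℚ f - Σℚ g
Σ-- f g = trans (Σ-+ f (λ i → - g i)) (cong (Σℚ f +_) (Σ-neg g))

Σ-swap : (f : Fin m → Fin n → ℚ) → Σℚ (λ i → Σℚ (λ j → f i j)) ≡ Σℚ (λ j → Σℚ (λ i → f i j))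
Σ-swap {zero} {n} f = sym (Σ-zero {n} (λ _ → refl))
Σ-swap {suc m} f = trans (cong (Σℚ (f zero) +_) (Σ-swap (f ∘ suc)))
                         (sym (Σ-+ (f zero) (λ j → Σℚ (λ i → f (suc i) j))))

Σ-single : {f : Fin m → ℚ} (i : Fin m) → (∀ j → j ≢ i → f j ≡ 0ℚ) → Σℚ f ≡ f i
Σ-single {f = f} zero    off = trans (cong (f zero +_) (Σ-zero (λ j → off (suc j) (λ ())))) (+-identityʳ (f zero))
Σ-single {f = f} (suc i) off = trans (cong₂ _+_ (off zero (λ ())) (Σ-single i (λ j j≢i → off (suc j) (j≢i ∘ Fin.suc-injective))))
                                     (+-identityˡ (f (suc i)))

Σ-mono-≤ : {f g : Fin m → ℚ} → (∀ i → f i ≤ g i) → Σℚ f ≤ Σℚ g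
Σ-mono-≤ {zero}  le = ≤-refl
Σ-mono-≤ {suc m} le = +-mono-≤ (le zero) (Σ-mono-≤ (le ∘ suc))

Σ-mono-< : {f g : Fin m → ℚ} → (∀ i → f i ≤ g i) → ∀ i → f i < g i → Σℚ f < Σℚ g
Σ-mono-< le zero    lt = +-mono-<-≤ lt (Σ-mono-≤ (le ∘ suc))
Σ-mono-< le (suc i) lt = +-mono-≤-< (le zero) (Σ-mono-< (le ∘ suc) i lt)

Σ≡0⇒≡0 : {f : Fin m → ℚ} → (∀ i → 0ℚ ≤ f i) → Σℚ f ≡ 0ℚ → ∀ i → f i ≡ 0ℚ
Σ≡0⇒≡0 {m} {f} 0≤f Σ≡0 i with f i ≟ 0ℚ
... | yes eq = eq
... | no neq = ⊥-elim (<⇒≢ (subst (_< Σℚ f) (Σ-zero {m} (λ _ → refl))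
                       (Σ-mono-< 0≤f i (≤∧≢⇒< (0≤f i) (neq ∘ sym)))) (sym Σ≡0))

Σ-ι : (f : Fin m → ℤ) → ι (Σℤ f) ≡ Σℚ (ι ∘ f)
Σ-ι {zero}  f = refl
Σ-ι {suc m} f = trans (ι-+ (f zero) (Σℤ (f ∘ suc))) (cong (ι (f zero) +_) (Σ-ι (f ∘ suc)))

IsInt-Σ : {f : Fin m → ℚ} → (∀ i → IsInt (f i)) → IsInt (Σℚ f)
IsInt-Σ {zero}  int = ℤ.+ 0 , refl
IsInt-Σ {suc m} int = IsInt-+ (int zero) (IsInt-Σ (int ∘ suc))

δ : Fin m → Fin m → ℚ
δ zero    zero    = 1ℚ
δ zero    (suc _) = 0ℚ
δ (suc _) zero    = 0ℚ
δ (suc i) (suc j) = δ i j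

δ-refl : (i : Fin m) → δ i i ≡ 1ℚ
δ-refl zero    = refl
δ-refl (suc i) = δ-refl i

δ-≢ : {i j : Fin m} → i ≢ j → δ i j ≡ 0ℚ
δ-≢ {i = zero}  {zero}  i≢j = ⊥-elim (i≢j refl)
δ-≢ {i = zero}  {suc j} i≢j = refl
δ-≢ {i = suc i} {zero}  i≢j = refl
δ-≢ {i = suc i} {suc j} i≢j = δ-≢ (i≢j ∘ cong suc)

δ-sym : (i j : Fin m) → δ i j ≡ δ j i
δ-sym zero    zero    = refl
δ-sym zero    (suc _) = refl
δ-sym (suc _) zero    = refl
δ-sym (suc i) (suc j) = δ-sym i j

IsInt-δ : (i j : Fin m) → IsInt (δ i j)
IsInt-δ zero    zero    = ℤ.+ 1 , refl
IsInt-δ zero    (suc _) = ℤ.+ 0 , refl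
IsInt-δ (suc _) zero    = ℤ.+ 0 , refl
IsInt-δ (suc i) (suc j) = IsInt-δ i j

Σ-δˡ : (i : Fin m) (f : Fin m → ℚ) → Σℚ (λ j → δ i j * f j) ≡ f i
Σ-δˡ i f = trans (Σ-single i (λ j j≢i → *-zeroˡ-≡ (f j) (δ-≢ (j≢i ∘ sym))))
                 (trans (cong (_* f i) (δ-refl i)) (*-identityˡ (f i)))

Σ-δʳ : (i : Fin m) (f : Fin m → ℚ) → Σℚ (λ j → f j * δ j i) ≡ f i
Σ-δʳ i f = trans (Σ-single i (λ j j≢i → *-zeroʳ-≡ (f j) (δ-≢ j≢i)))
                 (trans (cong (f i *_) (δ-refl i)) (*-identityʳ (f i)))

-- The bilinear form

dot-cong : {x x′ y y′ : Pt r} → x ≈ x′ → y ≈ y′ → dot x y ≡ dot x′ y′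
dot-cong x≈ y≈ = Σ-cong (λ a → cong₂ _*_ (x≈ a) (y≈ a))

dot-comm : (x y : Pt r) → dot x y ≡ dot y x
dot-comm x y = Σ-cong (λ a → *-comm (x a) (y a))

dot-zeroˡ : {x : Pt r} (y : Pt r) → (∀ a → x a ≡ 0ℚ) → dot x y ≡ 0ℚ
dot-zeroˡ y x≡0 = Σ-zero (λ a → *-zeroˡ-≡ (y a) (x≡0 a))

dot-negʳ : (x y : Pt r) → dot x (λ a → - y a) ≡ - dot x y
dot-negʳ x y = trans (Σ-cong (λ a → sym (neg-distribʳ-* (x a) (y a)))) (Σ-neg (λ a → x a * y a))

dot-negˡ : (x y : Pt r) → dot (λ a → - x a) y ≡ - dot x y
dot-negˡ x y = trans (Σ-cong (λ a → sym (neg-distribˡ-* (x a) (y a)))) (Σ-neg (λ a → x a * y a))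

dot-sub : (x y z : Pt r) → dot x (λ a → y a - z a) ≡ dot x y - dot x z
dot-sub x y z = trans (Σ-cong (λ a → lemma (x a) (y a) (z a))) (Σ-- (λ a → x a * y a) (λ a → x a * z a))
  where
  lemma : ∀ p q s → p * (q - s) ≡ p * q - p * s
  lemma = solve-∀ ℚ-ring

dot-*ˡ : ∀ s (x y : Pt r) → dot (λ a → s * x a) y ≡ s * dot x y
dot-*ˡ s x y = trans (Σ-cong (λ a → *-assoc s (x a) (y a))) (Σ-*ˡ s (λ a → x a * y a))

dot-Σʳ : (x : Pt r) (c : Fin k → ℚ) (v : Fin k → Pt r) →
         dot x (λ a → Σℚ (λ j → c j * v j a)) ≡ Σℚ (λ j → c j * dot x (v j))
dot-Σʳ x c v = begin
  Σℚ (λ a → x a * Σℚ (λ j → c j * v j a))    ≡⟨ Σ-cong (λ a → sym (Σ-*ˡ (x a) (λ j → c j * v j a))) ⟩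
  Σℚ (λ a → Σℚ (λ j → x a * (c j * v j a)))  ≡⟨ Σ-swap (λ a j → x a * (c j * v j a)) ⟩
  Σℚ (λ j → Σℚ (λ a → x a * (c j * v j a)))  ≡⟨ Σ-cong (λ j → Σ-cong (λ a → lemma (x a) (c j) (v j a))) ⟩
  Σℚ (λ j → Σℚ (λ a → c j * (x a * v j a)))  ≡⟨ Σ-cong (λ j → Σ-*ˡ (c j) (λ a → x a * v j a)) ⟩
  Σℚ (λ j → c j * dot x (v j))               ∎
  where
  open ≡-Reasoning
  lemma : ∀ p q s → p * (q * s) ≡ q * (p * s)
  lemma = solve-∀ ℚ-ring

-- Used to isolate a coefficient: apply a functional that vanishes on all vectors of the relation
-- but one.
dot-relation : (x : Pt r) (c : Fin k → ℚ) (v : Fin k → Pt r) →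
               (∀ a → Σℚ (λ j → c j * v j a) ≡ 0ℚ) → Σℚ (λ j → c j * dot x (v j)) ≡ 0ℚ
dot-relation x c v rel = trans (sym (dot-Σʳ x c v)) (trans (dot-comm x _) (dot-zeroˡ x rel))

-- Finite search and replacement of one member of a family

any⊎all : {P : Fin m → Set} → (∀ i → Dec (P i)) → (∃ P) ⊎ (∀ i → ¬ P i)
any⊎all P? with Fin.any? P?
... | yes p = inj₁ p
... | no ¬p = inj₂ (λ i pi → ¬p (i , pi))

nonzero⊎zero : (x : Pt r) → (∃ λ a → x a ≢ 0ℚ) ⊎ (∀ a → x a ≡ 0ℚ)
nonzero⊎zero x with any⊎all (λ a → ¬? (x a ≟ 0ℚ))
... | inj₁ p = inj₁ p
... | inj₂ p = inj₂ (λ a → decidable-stable (x a ≟ 0ℚ) (p a))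

_[_≔_] : (Fin m → A) → Fin m → A → Fin m → A
(W [ p ≔ x ]) j with j Fin.≟ p
... | yes _ = x
... | no  _ = W j

≔-at : (W : Fin m → A) (p : Fin m) (x : A) → (W [ p ≔ x ]) p ≡ x
≔-at W p x with p Fin.≟ p
... | yes _  = refl
... | no p≢p = ⊥-elim (p≢p refl)

≔-off : (W : Fin m → A) {p : Fin m} (x : A) {j : Fin m} → j ≢ p → (W [ p ≔ x ]) j ≡ W j
≔-off W {p} x {j} j≢p with j Fin.≟ p
... | yes j≡p = ⊥-elim (j≢p j≡p)
... | no  _   = refl

≡⇒≈ : {x y : Pt r} → x ≡ y → x ≈ y
≡⇒≈ refl a = refl

-- Determinants over ℚ, as functions of the family of columns

submatrix : (Fin (suc k) → Pt (suc k)) → Fin (suc k) → Fin k → Pt k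
submatrix W j b c = W (punchIn j b) (suc c)

-- Laplace expansion along the first row as in `det`, transposed so that a column is a single
-- argument and can be replaced or expanded as a vector. Entries are rational because such
-- expansions have rational coefficients.
Det : (Fin k → Pt k) → ℚ
Det {zero}  W = 1ℚ
Det {suc k} W = Σℚ (λ j → ι (sgn (toℕ j)) * (W j zero * Det (submatrix W j)))

Det-ι : (A : Fin k → Fin k → ℤ) → ι (det k A) ≡ Det (λ j c → ι (A c j))
Det-ι {zero}  A = refl
Det-ι {suc k} A = trans (Σ-ι (λ j → sgn (toℕ j) ℤ.* (A zero j ℤ.* det k (λ a b → A (suc a) (punchIn j b))))) (Σ-cong (λ j → begin
  ι (sgn (toℕ j) ℤ.* (A zero j ℤ.* det k (λ a b → A (suc a) (punchIn j b))))
    ≡⟨ ι-* (sgn (toℕ j)) _ ⟩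
  ι (sgn (toℕ j)) * ι (A zero j ℤ.* det k (λ a b → A (suc a) (punchIn j b)))
    ≡⟨ cong (ι (sgn (toℕ j)) *_) (ι-* (A zero j) _) ⟩
  ι (sgn (toℕ j)) * (ι (A zero j) * ι (det k (λ a b → A (suc a) (punchIn j b))))
    ≡⟨ cong (λ d → ι (sgn (toℕ j)) * (ι (A zero j) * d)) (Det-ι (λ a b → A (suc a) (punchIn j b))) ⟩
  ι (sgn (toℕ j)) * (ι (A zero j) * Det (submatrix (λ j c → ι (A c j)) j)) ∎))
  where open ≡-Reasoning

Det-cong : {W W′ : Fin k → Pt k} → (∀ j → W j ≈ W′ j) → Det W ≡ Det W′
Det-cong {zero}  eq = refl
Det-cong {suc k} eq = Σ-cong (λ j → cong (ι (sgn (toℕ j)) *_)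
  (cong₂ _*_ (eq j zero) (Det-cong (λ b c → eq (punchIn j b) (suc c)))))

IsInt-Det : {W : Fin k → Pt k} → (∀ j c → IsInt (W j c)) → IsInt (Det W)
IsInt-Det {zero}  int = ℤ.+ 1 , refl
IsInt-Det {suc k} int = IsInt-Σ (λ j → IsInt-* (sgn (toℕ j) , refl)
  (IsInt-* (int j zero) (IsInt-Det (λ b c → int (punchIn j b) (suc c)))))

Det-δ : ∀ k → Det {k} δ ≡ 1ℚ
Det-δ zero    = refl
Det-δ (suc k) = begin
  Det {suc k} δ          ≡⟨ Σ-single {suc k} zero off ⟩
  1ℚ * (1ℚ * Det {k} δ)  ≡⟨ trans (*-identityˡ (1ℚ * Det {k} δ)) (*-identityˡ (Det {k} δ)) ⟩
  Det {k} δ              ≡⟨ Det-δ k ⟩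
  1ℚ                     ∎
  where
  open ≡-Reasoning
  off : (j : Fin (suc k)) → j ≢ zero → ι (sgn (toℕ j)) * (δ {suc k} j zero * Det {k} (submatrix δ j)) ≡ 0ℚ
  off zero    0≢0 = ⊥-elim (0≢0 refl)
  off (suc j) _   = *-zeroʳ-≡ (ι (sgn (suc (toℕ j)))) (*-zeroˡ (Det {k} (submatrix δ (suc j))))

-- Agreement off `p` is asked pointwise rather than through updates, so that the hypothesis passes
-- to the submatrices of the expansion. The term at `p` splits through its entry, every other term
-- through its minor.
Det-linear : (p : Fin k) (s t : ℚ) (W X Y : Fin k → Pt k) →
             (∀ j → j ≢ p → X j ≈ W j) → (∀ j → j ≢ p → Y j ≈ W j) →
             (∀ a → W p a ≡ s * X p a + t * Y p a) →
             Det W ≡ s * Det X + t * Det Y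
Det-linear {suc k} p s t W X Y X≈W Y≈W Wp = begin
  Σℚ (term W)                                    ≡⟨ Σ-cong split ⟩
  Σℚ (λ j → s * term X j + t * term Y j)         ≡⟨ Σ-+ (λ j → s * term X j) (λ j → t * term Y j) ⟩
  Σℚ (λ j → s * term X j) + Σℚ (λ j → t * term Y j)  ≡⟨ cong₂ _+_ (Σ-*ˡ s (term X)) (Σ-*ˡ t (term Y)) ⟩
  s * Σℚ (term X) + t * Σℚ (term Y)              ∎
  where
  open ≡-Reasoning
  term : (Fin (suc k) → Pt (suc k)) → Fin (suc k) → ℚ
  term V j = ι (sgn (toℕ j)) * (V j zero * Det (submatrix V j))
  lemma₁ : ∀ g d x y s t → g * ((s * x + t * y) * d) ≡ s * (g * (x * d)) + t * (g * (y * d))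
  lemma₁ = solve-∀ ℚ-ring
  lemma₂ : ∀ g w x y s t → g * (w * (s * x + t * y)) ≡ s * (g * (w * x)) + t * (g * (w * y))
  lemma₂ = solve-∀ ℚ-ring
  split : ∀ j → term W j ≡ s * term X j + t * term Y j
  split j with j Fin.≟ p
  ... | yes refl = begin
    g * (W p zero * Det (submatrix W p))
      ≡⟨ cong (λ w → g * (w * Det (submatrix W p))) (Wp zero) ⟩
    g * ((s * X p zero + t * Y p zero) * Det (submatrix W p))
      ≡⟨ lemma₁ g (Det (submatrix W p)) (X p zero) (Y p zero) s t ⟩
    s * (g * (X p zero * Det (submatrix W p))) + t * (g * (Y p zero * Det (submatrix W p)))
      ≡⟨ cong₂ (λ x y → s * (g * (X p zero * x)) + t * (g * (Y p zero * y)))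
           (Det-cong (λ b c → sym (X≈W (punchIn p b) (Fin.punchInᵢ≢i p b) (suc c))))
           (Det-cong (λ b c → sym (Y≈W (punchIn p b) (Fin.punchInᵢ≢i p b) (suc c)))) ⟩
    s * term X p + t * term Y p ∎
    where g = ι (sgn (toℕ p))
  ... | no j≢p = begin
    g * (W j zero * Det (submatrix W j))
      ≡⟨ cong (λ d → g * (W j zero * d)) (Det-linear p′ s t (submatrix W j) (submatrix X j) (submatrix Y j)
           (λ b b≢p′ c → X≈W (punchIn j b) (avoid b b≢p′) (suc c))
           (λ b b≢p′ c → Y≈W (punchIn j b) (avoid b b≢p′) (suc c))
           (λ c → subst (λ q → W q (suc c) ≡ s * X q (suc c) + t * Y q (suc c))
                    (sym (Fin.punchIn-punchOut j≢p)) (Wp (suc c)))) ⟩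
    g * (W j zero * (s * Det (submatrix X j) + t * Det (submatrix Y j)))
      ≡⟨ lemma₂ g (W j zero) (Det (submatrix X j)) (Det (submatrix Y j)) s t ⟩
    s * (g * (W j zero * Det (submatrix X j))) + t * (g * (W j zero * Det (submatrix Y j)))
      ≡⟨ cong₂ (λ x y → s * (g * (x * Det (submatrix X j))) + t * (g * (y * Det (submatrix Y j))))
           (sym (X≈W j j≢p zero)) (sym (Y≈W j j≢p zero)) ⟩
    s * term X j + t * term Y j ∎
    where
    g = ι (sgn (toℕ j))
    p′ = punchOut j≢p
    avoid : ∀ b → b ≢ p′ → punchIn j b ≢ p
    avoid b b≢p′ eq = b≢p′ (Fin.punchIn-injective j b p′ (trans eq (sym (Fin.punchIn-punchOut j≢p))))

-- Alternation of the determinant and expansion in one column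

data Adjacent : Fin n → Fin n → Set where
  here  : Adjacent {suc (suc n)} zero (suc zero)
  there : {p q : Fin n} → Adjacent p q → Adjacent (suc p) (suc q)

Adjacent-≢ : {p q : Fin n} → Adjacent p q → p ≢ q
Adjacent-≢ (there adj) eq = Adjacent-≢ adj (Fin.suc-injective eq)

Adjacent-toℕ : {p q : Fin n} → Adjacent p q → toℕ q ≡ suc (toℕ p)
Adjacent-toℕ here        = refl
Adjacent-toℕ (there adj) = cong suc (Adjacent-toℕ adj)

Adjacent-punchOut : {j p q : Fin (suc n)} → Adjacent p q → (j≢p : j ≢ p) (j≢q : j ≢ q) →
                    Adjacent (punchOut j≢p) (punchOut j≢q)
Adjacent-punchOut {j = zero}        here        j≢p j≢q = ⊥-elim (j≢p refl)
Adjacent-punchOut {j = zero}        (there adj) j≢p j≢q = adj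
Adjacent-punchOut {j = suc zero}    here        j≢p j≢q = ⊥-elim (j≢q refl)
Adjacent-punchOut {n = suc (suc n)} {j = suc (suc j)} here j≢p j≢q = here
Adjacent-punchOut {n = suc n} {j = suc j} (there adj) j≢p j≢q =
  there (Adjacent-punchOut adj (j≢p ∘ cong suc) (j≢q ∘ cong suc))

-- Deleting `p` or deleting `q` leaves the same positions, except that one of them reads `q` in the
-- first case and `p` in the second. With equal columns at `p` and `q` the two minors coincide.
Adjacent-punchIn : {p q : Fin (suc n)} → Adjacent p q → (b : Fin n) →
                   (punchIn p b ≡ punchIn q b) ⊎ ((punchIn p b ≡ q) × (punchIn q b ≡ p))
Adjacent-punchIn here        zero    = inj₂ (refl , refl)
Adjacent-punchIn here        (suc b) = inj₁ refl
Adjacent-punchIn (there adj) zero    = inj₁ refl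
Adjacent-punchIn (there adj) (suc b) with Adjacent-punchIn adj b
... | inj₁ eq         = inj₁ (cong suc eq)
... | inj₂ (eq , eq′) = inj₂ (cong suc eq , cong suc eq′)

Σ-adjacent : {f : Fin m → ℚ} {p q : Fin m} → Adjacent p q →
             (∀ j → j ≢ p → j ≢ q → f j ≡ 0ℚ) → f p + f q ≡ 0ℚ → Σℚ f ≡ 0ℚ
Σ-adjacent {f = f} here off eq = begin
  f zero + (f (suc zero) + Σℚ (λ i → f (suc (suc i))))
    ≡⟨ cong (λ t → f zero + (f (suc zero) + t)) (Σ-zero (λ i → off (suc (suc i)) (λ ()) (λ ()))) ⟩
  f zero + (f (suc zero) + 0ℚ)
    ≡⟨ cong (f zero +_) (+-identityʳ _) ⟩
  f zero + f (suc zero)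
    ≡⟨ eq ⟩
  0ℚ ∎
  where open ≡-Reasoning
Σ-adjacent (there adj) off eq = cong₂ _+_ (off zero (λ ()) (λ ()))
  (Σ-adjacent adj (λ j j≢p j≢q → off (suc j) (j≢p ∘ Fin.suc-injective) (j≢q ∘ Fin.suc-injective)) eq)

-- A term away from `p` and `q` has a minor that again contains two equal adjacent columns. The
-- terms at `p` and `q` have equal entries and equal minors but opposite signs, so they cancel.
Det-adjacent : {p q : Fin k} → Adjacent p q → (W : Fin k → Pt k) → W p ≈ W q → Det W ≡ 0ℚ
Det-adjacent {suc k} {p} {q} adj W Wp≈Wq = Σ-adjacent adj off cancel
  where
  open ≡-Reasoning
  term : Fin (suc k) → ℚ
  term j = ι (sgn (toℕ j)) * (W j zero * Det (submatrix W j))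
  off : ∀ j → j ≢ p → j ≢ q → term j ≡ 0ℚ
  off j j≢p j≢q = *-zeroʳ-≡ (ι (sgn (toℕ j))) (*-zeroʳ-≡ (W j zero)
    (Det-adjacent (Adjacent-punchOut adj j≢p j≢q) (submatrix W j)
      (λ c → trans (cong (λ i → W i (suc c)) (Fin.punchIn-punchOut j≢p))
               (trans (Wp≈Wq (suc c)) (cong (λ i → W i (suc c)) (sym (Fin.punchIn-punchOut j≢q)))))))
  same : ∀ b → W (punchIn q b) ≈ W (punchIn p b)
  same b with Adjacent-punchIn adj b
  ... | inj₁ eq         = λ a → cong (λ i → W i a) (sym eq)
  ... | inj₂ (eq , eq′) = λ a → trans (cong (λ i → W i a) eq′) (trans (Wp≈Wq a) (cong (λ i → W i a) (sym eq)))
  lemma : ∀ g d → g * d + - g * d ≡ 0ℚ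
  lemma = solve-∀ ℚ-ring
  cancel : term p + term q ≡ 0ℚ
  cancel = begin
    term p + term q
      ≡⟨ cong₂ (λ g d → term p + g * d)
           (trans (cong (ι ∘ sgn) (Adjacent-toℕ adj)) (ι-neg (sgn (toℕ p))))
           (cong₂ _*_ (sym (Wp≈Wq zero)) (Det-cong (λ b c → same b (suc c)))) ⟩
    term p + - ι (sgn (toℕ p)) * (W p zero * Det (submatrix W p))
      ≡⟨ lemma (ι (sgn (toℕ p))) (W p zero * Det (submatrix W p)) ⟩
    0ℚ ∎

Det-+ : (W : Fin k → Pt k) (p : Fin k) (x y : Pt k) →
        Det (W [ p ≔ (λ a → x a + y a) ]) ≡ Det (W [ p ≔ x ]) + Det (W [ p ≔ y ])
Det-+ W p x y = trans
  (Det-linear p 1ℚ 1ℚ _ _ _ (agree x) (agree y)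
    (λ a → trans (≡⇒≈ (≔-at W p _) a)
      (sym (cong₂ _+_ (trans (*-identityˡ _) (≡⇒≈ (≔-at W p x) a)) (trans (*-identityˡ _) (≡⇒≈ (≔-at W p y) a))))))
  (cong₂ _+_ (*-identityˡ (Det (W [ p ≔ x ]))) (*-identityˡ (Det (W [ p ≔ y ]))))
  where
  agree : ∀ z j → j ≢ p → (W [ p ≔ z ]) j ≈ (W [ p ≔ (λ a → x a + y a) ]) j
  agree z j j≢p = ≡⇒≈ (trans (≔-off W z j≢p) (sym (≔-off W _ j≢p)))

-- Expand 0 = det(…, x + y, x + y, …) by additivity in both columns.
Det-swap : {p q : Fin k} → Adjacent p q → (W W′ : Fin k → Pt k) →
           (∀ j → j ≢ p → j ≢ q → W′ j ≈ W j) → W′ p ≈ W q → W′ q ≈ W p →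
           Det W + Det W′ ≡ 0ℚ
Det-swap {k} {p} {q} adj W W′ off W′p W′q = begin
  Det W + Det W′
    ≡⟨ cong₂ _+_ (Det-cong E-xy) (Det-cong E-yx) ⟩
  Det (E x y) + Det (E y x)
    ≡⟨ cong₂ _+_ (sym (+-identityˡ (Det (E x y)))) (sym (+-identityʳ (Det (E y x)))) ⟩
  (0ℚ + Det (E x y)) + (Det (E y x) + 0ℚ)
    ≡⟨ cong₂ (λ a b → (a + Det (E x y)) + (Det (E y x) + b)) (sym (E-diag x)) (sym (E-diag y)) ⟩
  (Det (E x x) + Det (E x y)) + (Det (E y x) + Det (E y y))
    ≡⟨ cong₂ _+_ (sym (Det-+ (W [ p ≔ x ]) q x y)) (sym (Det-+ (W [ p ≔ y ]) q x y)) ⟩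
  Det (E x x+y) + Det (E y x+y)
    ≡⟨ cong₂ _+_ (flip x) (flip y) ⟩
  Det ((W [ q ≔ x+y ]) [ p ≔ x ]) + Det ((W [ q ≔ x+y ]) [ p ≔ y ])
    ≡⟨ sym (Det-+ (W [ q ≔ x+y ]) p x y) ⟩
  Det ((W [ q ≔ x+y ]) [ p ≔ x+y ])
    ≡⟨ sym (flip x+y) ⟩
  Det (E x+y x+y)
    ≡⟨ E-diag x+y ⟩
  0ℚ ∎
  where
  open ≡-Reasoning
  p≢q = Adjacent-≢ adj
  x y x+y : Pt k
  x = W p
  y = W q
  x+y a = x a + y a
  E : Pt k → Pt k → Fin k → Pt k
  E s t = (W [ p ≔ s ]) [ q ≔ t ]
  E-p : ∀ s t → E s t p ≡ s
  E-p s t = trans (≔-off (W [ p ≔ s ]) t p≢q) (≔-at W p s)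
  E-q : ∀ s t → E s t q ≡ t
  E-q s t = ≔-at (W [ p ≔ s ]) q t
  E-unique : ∀ s t (V : Fin k → Pt k) → V p ≈ s → V q ≈ t → (∀ j → j ≢ p → j ≢ q → V j ≈ W j) → ∀ j → V j ≈ E s t j
  E-unique s t V Vp Vq Voff j a with j Fin.≟ p
  ... | yes refl = trans (Vp a) (sym (≡⇒≈ (E-p s t) a))
  ... | no j≢p with j Fin.≟ q
  ...   | yes refl = Vq a
  ...   | no j≢q = trans (Voff j j≢p j≢q a) (sym (≡⇒≈ (≔-off W s j≢p) a))
  E-xy : ∀ j → W j ≈ E x y j
  E-xy = E-unique x y W (λ _ → refl) (λ _ → refl) (λ _ _ _ _ → refl)
  E-yx : ∀ j → W′ j ≈ E y x j
  E-yx = E-unique y x W′ W′p W′q off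
  E-diag : ∀ s → Det (E s s) ≡ 0ℚ
  E-diag s = Det-adjacent adj (E s s) (≡⇒≈ (trans (E-p s s) (sym (E-q s s))))
  flip : ∀ s → Det (E s x+y) ≡ Det ((W [ q ≔ x+y ]) [ p ≔ s ])
  flip s = sym (Det-cong (E-unique s x+y ((W [ q ≔ x+y ]) [ p ≔ s ])
    (≡⇒≈ (≔-at (W [ q ≔ x+y ]) p s))
    (≡⇒≈ (trans (≔-off (W [ q ≔ x+y ]) s (p≢q ∘ sym)) (≔-at W q x+y)))
    (λ j j≢p j≢q → ≡⇒≈ (trans (≔-off (W [ q ≔ x+y ]) s j≢p) (≔-off W x+y j≢q)))))

-- The strict order on positions as a chain of adjacent steps, so that induction can shorten the
-- distance between two columns.
data _◁_ : Fin n → Fin n → Set where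
  [_]  : {p q : Fin n} → Adjacent p q → p ◁ q
  _∷_  : {p s q : Fin n} → Adjacent p s → s ◁ q → p ◁ q

◁-suc : {p q : Fin n} → p ◁ q → suc p ◁ suc q
◁-suc [ adj ]     = [ there adj ]
◁-suc (adj ∷ p◁q) = there adj ∷ ◁-suc p◁q

zero◁suc : (q : Fin n) → zero ◁ suc q
zero◁suc zero    = [ here ]
zero◁suc (suc q) = here ∷ ◁-suc (zero◁suc q)

◁-connex : {p q : Fin n} → p ≢ q → (p ◁ q) ⊎ (q ◁ p)
◁-connex {p = zero}  {zero}  p≢q = ⊥-elim (p≢q refl)
◁-connex {p = zero}  {suc q} p≢q = inj₁ (zero◁suc q)
◁-connex {p = suc p} {zero}  p≢q = inj₂ (zero◁suc p)
◁-connex {p = suc p} {suc q} p≢q with ◁-connex (p≢q ∘ cong suc)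
... | inj₁ p◁q = inj₁ (◁-suc p◁q)
... | inj₂ q◁p = inj₂ (◁-suc q◁p)

◁-toℕ : {p q : Fin n} → p ◁ q → toℕ p ℕ.< toℕ q
◁-toℕ [ adj ]     = ℕ.≤-reflexive (sym (Adjacent-toℕ adj))
◁-toℕ (adj ∷ s◁q) = ℕ.<-trans (ℕ.≤-reflexive (sym (Adjacent-toℕ adj))) (◁-toℕ s◁q)

◁-≢ : {p q : Fin n} → p ◁ q → q ≢ p
◁-≢ p◁q refl = ℕ.<-irrefl refl (◁-toℕ p◁q)

-- Exchanging `p` with its right neighbour `s` only changes the sign and brings the equal columns
-- one step closer, where the induction hypothesis applies.
Det-◁ : {p q : Fin k} → p ◁ q → (W : Fin k → Pt k) → W p ≈ W q → Det W ≡ 0ℚ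
Det-◁ [ adj ] W Wp≈Wq = Det-adjacent adj W Wp≈Wq
Det-◁ {k} {p} {q} (_∷_ {s = s} adj s◁q) W Wp≈Wq = begin
  Det W            ≡⟨ sym (+-identityʳ _) ⟩
  Det W + 0ℚ       ≡⟨ cong (Det W +_) (sym (Det-◁ s◁q W′ W′s≈W′q)) ⟩
  Det W + Det W′   ≡⟨ Det-swap adj W W′ W′-off (≡⇒≈ W′-p) (≡⇒≈ W′-s) ⟩
  0ℚ               ∎
  where
  open ≡-Reasoning
  W′ : Fin k → Pt k
  W′ = (W [ p ≔ W s ]) [ s ≔ W p ]
  W′-p : W′ p ≡ W s
  W′-p = trans (≔-off (W [ p ≔ W s ]) (W p) (Adjacent-≢ adj)) (≔-at W p (W s))
  W′-s : W′ s ≡ W p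
  W′-s = ≔-at (W [ p ≔ W s ]) s (W p)
  W′-off : ∀ j → j ≢ p → j ≢ s → W′ j ≈ W j
  W′-off j j≢p j≢s = ≡⇒≈ (trans (≔-off (W [ p ≔ W s ]) (W p) j≢s) (≔-off W (W s) j≢p))
  W′s≈W′q : W′ s ≈ W′ q
  W′s≈W′q a = trans (≡⇒≈ W′-s a) (trans (Wp≈Wq a) (sym (W′-off q (◁-≢ (adj ∷ s◁q)) (◁-≢ s◁q) a)))

Det-alternating : {p q : Fin k} → p ≢ q → (W : Fin k → Pt k) → W p ≈ W q → Det W ≡ 0ℚ
Det-alternating p≢q W Wp≈Wq with ◁-connex p≢q
... | inj₁ p◁q = Det-◁ p◁q W Wp≈Wq
... | inj₂ q◁p = Det-◁ q◁p W (λ a → sym (Wp≈Wq a))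

Det-Σ : (W : Fin k → Pt k) (p : Fin k) (t : Fin m → ℚ) (Y : Fin m → Pt k) →
        Det (W [ p ≔ (λ a → Σℚ (λ b → t b * Y b a)) ]) ≡ Σℚ (λ b → t b * Det (W [ p ≔ Y b ]))
Det-Σ {m = zero} W p t Y = trans
  -- An empty sum makes column `p` zero, written here as `0 * W p + 0 * W p`.
  (Det-linear p 0ℚ 0ℚ _ W W
    (λ j j≢p → ≡⇒≈ (sym (≔-off W _ j≢p))) (λ j j≢p → ≡⇒≈ (sym (≔-off W _ j≢p)))
    (λ a → trans (≡⇒≈ (≔-at W p _) a) (sym (vanish (W p a)))))
  (vanish (Det W))
  where
  vanish : ∀ x → 0ℚ * x + 0ℚ * x ≡ 0ℚ
  vanish = solve-∀ ℚ-ring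
Det-Σ {m = suc m} W p t Y = trans
  (Det-linear p (t zero) 1ℚ _ (W [ p ≔ Y zero ]) (W [ p ≔ rest ])
    (λ j j≢p → ≡⇒≈ (trans (≔-off W _ j≢p) (sym (≔-off W _ j≢p))))
    (λ j j≢p → ≡⇒≈ (trans (≔-off W _ j≢p) (sym (≔-off W _ j≢p))))
    (λ a → trans (≡⇒≈ (≔-at W p _) a) (sym (cong₂ _+_
      (cong (t zero *_) (≡⇒≈ (≔-at W p (Y zero)) a))
      (trans (*-identityˡ _) (≡⇒≈ (≔-at W p rest) a))))))
  (cong (t zero * Det (W [ p ≔ Y zero ]) +_) (trans (*-identityˡ _) (Det-Σ W p (t ∘ suc) (Y ∘ suc))))
  where
  rest : Pt _
  rest a = Σℚ (λ b → t (suc b) * Y (suc b) a)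

-- Bases with their dual bases

-- Dual vectors, coordinates and the nonvanishing determinant travel together because an exchange
-- updates all of them by explicit formulas. Every basis is reached from the standard one by
-- exchanges, so no matrix is ever inverted.
record Basis (w : Fin r → Pt r) : Set where
  field
    dual   : Fin r → Pt r
    dual-δ : ∀ a b → dot (dual a) (w b) ≡ δ a b
    expand : ∀ x → x ≈ (λ c → Σℚ (λ a → dot (dual a) x * w a c))
    det≢0  : Det w ≢ 0ℚ

open Basis

Basis-δ : Basis {r} δ
Basis-δ {r} = record
  { dual   = δ
  ; dual-δ = λ a b → trans (Σ-δˡ a (δ b)) (δ-sym b a)
  ; expand = λ x c → sym (trans (Σ-cong (λ a → cong (_* δ a c) (Σ-δˡ a x))) (Σ-δʳ c x))
  ; det≢0  = λ eq → 1≢0 (trans (sym (Det-δ r)) eq)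
  }

Basis-cong : {w w′ : Fin r → Pt r} → (∀ a → w a ≈ w′ a) → Basis w → Basis w′
Basis-cong w≈w′ B = record
  { dual   = dual B
  ; dual-δ = λ a b → trans (dot-cong {x = dual B a} (λ _ → refl) (λ c → sym (w≈w′ b c))) (dual-δ B a b)
  ; expand = λ x c → trans (expand B x c) (Σ-cong (λ a → cong (dot (dual B a) x *_) (w≈w′ a c)))
  ; det≢0  = λ eq → det≢0 B (trans (Det-cong w≈w′) eq)
  }

Basis⇒LinIndep : {w : Fin r → Pt r} → Basis w → LinIndep w
Basis⇒LinIndep {w = w} B c rel a = begin
  c a                                     ≡⟨ sym (Σ-δʳ a c) ⟩
  Σℚ (λ b → c b * δ b a)                  ≡⟨ Σ-cong (λ b → cong (c b *_) (trans (δ-sym b a) (sym (dual-δ B a b)))) ⟩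
  Σℚ (λ b → c b * dot (dual B a) (w b))   ≡⟨ dot-relation (dual B a) c w rel ⟩
  0ℚ                                      ∎
  where open ≡-Reasoning

-- Expanding the standard vectors `δ b` in the basis and applying `u` gives this. It turns values ±1
-- on a basis with integral dual into integrality of `u`.
Basis-expand-dual : {w : Fin r → Pt r} (B : Basis w) (u : Pt r) →
                    ∀ b → u b ≡ Σℚ (λ a → dual B a b * dot u (w a))
Basis-expand-dual {w = w} B u b = begin
  u b
    ≡⟨ sym (Σ-δʳ b u) ⟩
  Σℚ (λ c → u c * δ c b)
    ≡⟨ Σ-cong (λ c → cong (u c *_) (trans (δ-sym c b) (expand B (δ b) c))) ⟩
  dot u (λ c → Σℚ (λ a → dot (dual B a) (δ b) * w a c))
    ≡⟨ dot-Σʳ u (λ a → dot (dual B a) (δ b)) w ⟩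
  Σℚ (λ a → dot (dual B a) (δ b) * dot u (w a))
    ≡⟨ Σ-cong (λ a → cong (_* dot u (w a)) (trans (dot-comm (dual B a) (δ b)) (Σ-δˡ b (dual B a)))) ⟩
  Σℚ (λ a → dual B a b * dot u (w a)) ∎
  where open ≡-Reasoning

-- After expanding `x` in column `a`, every term with `b ≢ a` repeats the column `w b` and vanishes.
-- `w′` is described up to `≈` because it also arises as the columns of an updated index tuple.
cramer : {w w′ : Fin r → Pt r} (B : Basis w) (a : Fin r) (x : Pt r) →
         (∀ b → b ≢ a → w′ b ≈ w b) → w′ a ≈ x → Det w′ ≡ dot (dual B a) x * Det w
cramer {w = w} {w′} B a x off at = begin
  Det w′
    ≡⟨ Det-cong agree ⟩
  Det (w [ a ≔ (λ c → Σℚ (λ b → dot (dual B b) x * w b c)) ])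
    ≡⟨ Det-Σ w a (λ b → dot (dual B b) x) w ⟩
  Σℚ (λ b → dot (dual B b) x * Det (w [ a ≔ w b ]))
    ≡⟨ Σ-single a (λ b b≢a → *-zeroʳ-≡ (dot (dual B b) x) (Det-alternating b≢a (w [ a ≔ w b ])
         (≡⇒≈ (trans (≔-off w (w b) b≢a) (sym (≔-at w a (w b))))))) ⟩
  dot (dual B a) x * Det (w [ a ≔ w a ])
    ≡⟨ cong (dot (dual B a) x *_) (Det-cong restore) ⟩
  dot (dual B a) x * Det w ∎
  where
  open ≡-Reasoning
  agree : ∀ b → w′ b ≈ (w [ a ≔ (λ c → Σℚ (λ b → dot (dual B b) x * w b c)) ]) b
  agree b c with b Fin.≟ a
  ... | yes refl = trans (at c) (expand B x c)
  ... | no b≢a   = off b b≢a c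
  restore : ∀ b → (w [ a ≔ w a ]) b ≈ w b
  restore b c with b Fin.≟ a
  ... | yes refl = refl
  ... | no _     = refl

-- Steinitz exchange; the determinant is multiplied by the coordinate of `x` at `a`, which is
-- nonzero.
exchange : {w w′ : Fin r → Pt r} (B : Basis w) (a : Fin r) (x : Pt r) → dot (dual B a) x ≢ 0ℚ →
           (∀ b → b ≢ a → w′ b ≈ w b) → w′ a ≈ x → Basis w′
exchange {r} {w} {w′} B a x ta≢0 off at = record
  { dual   = g′
  ; dual-δ = g′-δ
  ; expand = g′-expand
  ; det≢0  = λ eq → det≢0 B (*-cancelʳ-≡0 ta≢0 (trans (*-comm (Det w) (t a)) (trans (sym (cramer {w = w} {w′} B a x off at)) eq)))
  }
  where
  open ≡-Reasoning
  g = dual B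
  t : Fin r → ℚ
  t b = dot (g b) x
  s : ℚ
  s = proj₁ (inverse ta≢0)
  s*ta≡1 : s * t a ≡ 1ℚ
  s*ta≡1 = proj₂ (inverse ta≢0)
  -- A rank-one correction covering both cases of the new dual basis: `g a / t a` at `a`, and
  -- `g b - (t b / t a) * g a` elsewhere; `s` is `1 / t a`.
  g′ : Fin r → Pt r
  g′ b c = g b c - ((t b - δ b a) * s) * g a c
  dot-g′ : ∀ b y → dot (g′ b) y ≡ dot (g b) y - ((t b - δ b a) * s) * dot (g a) y
  dot-g′ b y = begin
    dot (g′ b) y
      ≡⟨ dot-comm (g′ b) y ⟩
    dot y (g′ b)
      ≡⟨ dot-sub y (g b) (λ c → ((t b - δ b a) * s) * g a c) ⟩
    dot y (g b) - dot y (λ c → ((t b - δ b a) * s) * g a c)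
      ≡⟨ cong₂ _-_ (dot-comm y (g b)) (trans (dot-comm y _) (dot-*ˡ ((t b - δ b a) * s) (g a) y)) ⟩
    dot (g b) y - ((t b - δ b a) * s) * dot (g a) y ∎
  lemma₁ : ∀ τ d s ta → τ - ((τ - d) * s) * ta ≡ τ - (τ - d) * (s * ta)
  lemma₁ = solve-∀ ℚ-ring
  lemma₂ : ∀ τ d → τ - (τ - d) * 1ℚ ≡ d
  lemma₂ = solve-∀ ℚ-ring
  lemma₃ : ∀ d q → d - q * 0ℚ ≡ d
  lemma₃ = solve-∀ ℚ-ring
  g′-δ : ∀ b e → dot (g′ b) (w′ e) ≡ δ b e
  g′-δ b e with e Fin.≟ a
  ... | yes refl = begin
    dot (g′ b) (w′ a)                    ≡⟨ dot-cong {x = g′ b} (λ _ → refl) at ⟩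
    dot (g′ b) x                         ≡⟨ dot-g′ b x ⟩
    t b - ((t b - δ b a) * s) * t a      ≡⟨ lemma₁ (t b) (δ b a) s (t a) ⟩
    t b - (t b - δ b a) * (s * t a)      ≡⟨ cong (λ q → t b - (t b - δ b a) * q) s*ta≡1 ⟩
    t b - (t b - δ b a) * 1ℚ             ≡⟨ lemma₂ (t b) (δ b a) ⟩
    δ b a                                ∎
  ... | no e≢a = begin
    dot (g′ b) (w′ e)                                      ≡⟨ dot-cong {x = g′ b} (λ _ → refl) (off e e≢a) ⟩
    dot (g′ b) (w e)                                       ≡⟨ dot-g′ b (w e) ⟩
    dot (g b) (w e) - ((t b - δ b a) * s) * dot (g a) (w e)  ≡⟨ cong₂ (λ p q → p - ((t b - δ b a) * s) * q) (dual-δ B b e) (trans (dual-δ B a e) (δ-≢ (e≢a ∘ sym))) ⟩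
    δ b e - ((t b - δ b a) * s) * 0ℚ                       ≡⟨ lemma₃ (δ b e) ((t b - δ b a) * s) ⟩
    δ b e                                                  ∎
  g′-expand : ∀ y → y ≈ (λ c → Σℚ (λ b → dot (g′ b) y * w′ b c))
  g′-expand y c = sym (begin
    Σℚ (λ b → dot (g′ b) y * w′ b c)
      ≡⟨ Σ-cong term ⟩
    Σℚ (λ b → (Y b * w b c - κ * (t b * w b c)) + (κ * x c) * δ b a)
      ≡⟨ Σ-+ (λ b → Y b * w b c - κ * (t b * w b c)) (λ b → (κ * x c) * δ b a) ⟩
    Σℚ (λ b → Y b * w b c - κ * (t b * w b c)) + Σℚ (λ b → (κ * x c) * δ b a)
      ≡⟨ cong₂ _+_ (Σ-- (λ b → Y b * w b c) (λ b → κ * (t b * w b c))) (Σ-δʳ a (λ _ → κ * x c)) ⟩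
    (Σℚ (λ b → Y b * w b c) - Σℚ (λ b → κ * (t b * w b c))) + κ * x c
      ≡⟨ cong₂ (λ p q → (p - q) + κ * x c) (sym (expand B y c))
           (trans (Σ-*ˡ κ (λ b → t b * w b c)) (cong (κ *_) (sym (expand B x c)))) ⟩
    (y c - κ * x c) + κ * x c
      ≡⟨ lemma₄ (y c) (κ * x c) ⟩
    y c ∎)
    where
    Y : Fin r → ℚ
    Y b = dot (g b) y
    -- The coordinate of `y` at the new vector `x`.
    κ : ℚ
    κ = s * Y a
    lemma₄ : ∀ p q → (p - q) + q ≡ p
    lemma₄ = solve-∀ ℚ-ring
    lemma₅ : ∀ Ya ta s x → (Ya - ((ta - 1ℚ) * s) * Ya) * x ≡ (Ya - (s * ta) * Ya) * x + (s * Ya) * x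
    lemma₅ = solve-∀ ℚ-ring
    lemma₆ : ∀ Ya ta s w x → (Ya * w - (s * Ya) * (ta * w)) + ((s * Ya) * x) * 1ℚ ≡ (Ya - (s * ta) * Ya) * w + (s * Ya) * x
    lemma₆ = solve-∀ ℚ-ring
    lemma₇ : ∀ p x z → (p - 1ℚ * p) * x + z ≡ z
    lemma₇ = solve-∀ ℚ-ring
    lemma₈ : ∀ Yb tb s Ya w kx → (Yb - ((tb - 0ℚ) * s) * Ya) * w ≡ (Yb * w - (s * Ya) * (tb * w)) + kx * 0ℚ
    lemma₈ = solve-∀ ℚ-ring
    -- The factor in front of `z` is zero since `s * t a ≡ 1`, so `z` is arbitrary; this trades `x`
    -- for `w a` in the term at `a`.
    collapse : ∀ z → (Y a - (s * t a) * Y a) * z + κ * x c ≡ κ * x c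
    collapse z = trans (cong (λ q → (Y a - q * Y a) * z + κ * x c) s*ta≡1) (lemma₇ (Y a) z (κ * x c))
    term : ∀ b → dot (g′ b) y * w′ b c ≡ (Y b * w b c - κ * (t b * w b c)) + (κ * x c) * δ b a
    term b with b Fin.≟ a
    ... | yes refl = begin
      dot (g′ a) y * w′ a c
        ≡⟨ cong₂ _*_ (trans (dot-g′ a y) (cong (λ d → Y a - ((t a - d) * s) * Y a) (δ-refl a))) (at c) ⟩
      (Y a - ((t a - 1ℚ) * s) * Y a) * x c
        ≡⟨ lemma₅ (Y a) (t a) s (x c) ⟩
      (Y a - (s * t a) * Y a) * x c + κ * x c
        ≡⟨ trans (collapse (x c)) (sym (collapse (w a c))) ⟩
      (Y a - (s * t a) * Y a) * w a c + κ * x c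
        ≡⟨ sym (lemma₆ (Y a) (t a) s (w a c) (x c)) ⟩
      (Y a * w a c - κ * (t a * w a c)) + (κ * x c) * 1ℚ
        ≡⟨ cong (λ d → (Y a * w a c - κ * (t a * w a c)) + (κ * x c) * d) (sym (δ-refl a)) ⟩
      (Y a * w a c - κ * (t a * w a c)) + (κ * x c) * δ a a ∎
    ... | no b≢a = begin
      dot (g′ b) y * w′ b c
        ≡⟨ cong₂ _*_ (trans (dot-g′ b y) (cong (λ d → Y b - ((t b - d) * s) * Y a) (δ-≢ b≢a))) (off b b≢a c) ⟩
      (Y b - ((t b - 0ℚ) * s) * Y a) * w b c
        ≡⟨ lemma₈ (Y b) (t b) s (Y a) (w b c) (κ * x c) ⟩
      (Y b * w b c - κ * (t b * w b c)) + (κ * x c) * 0ℚ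
        ≡⟨ cong (λ d → (Y b * w b c - κ * (t b * w b c)) + (κ * x c) * d) (sym (δ-≢ b≢a)) ⟩
      (Y b * w b c - κ * (t b * w b c)) + (κ * x c) * δ b a ∎

-- Extracting a basis from a set of vectors

Annihilated : (Fin n → Pt r) → (Fin n → Set) → Set
Annihilated {r = r} V D = Σ (Pt r) λ y → (∃ λ a → y a ≢ 0ℚ) × (∀ i → D i → dot y (V i) ≡ 0ℚ)

-- Starting from the standard basis, exchange its members one by one for members of D;
-- when this is impossible at position a, the dual vector at a annihilates D.
annihilated⊎basis : (V : Fin n → Pt r) {D : Fin n → Set} → (∀ i → Dec (D i)) →
                    Annihilated V D ⊎ Σ (Fin r → Fin n) λ σ → (∀ a → D (σ a)) × Basis (V ∘ σ)
annihilated⊎basis {n} {r} V {D} D? with go r ℕ.≤-refl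
  where
  Partial : ℕ → Set
  Partial t = Σ (Fin r → Pt r) λ w → Basis w × (∀ a → toℕ a ℕ.< t → ∃ λ i → D i × w a ≡ V i)
  go : ∀ t → t ℕ.≤ r → Annihilated V D ⊎ Partial t
  go zero    _   = inj₂ (δ , Basis-δ , λ _ ())
  go (suc t) t<r with go t (ℕ.<⇒≤ t<r)
  ... | inj₁ ann = inj₁ ann
  ... | inj₂ (w , B , old) with any⊎all (λ i → D? i ×-dec ¬? (dot (dual B (fromℕ< t<r)) (V i) ≟ 0ℚ))
  ...   | inj₁ (i , Di , ≢0) =
    inj₂ (w [ a ≔ V i ] , exchange {w = w} B a (V i) ≢0 (λ b b≢a → ≡⇒≈ (≔-off w (V i) b≢a)) (≡⇒≈ (≔-at w a (V i))) , new)
    where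
    a = fromℕ< t<r
    new : ∀ b → toℕ b ℕ.< suc t → ∃ λ j → D j × (w [ a ≔ V i ]) b ≡ V j
    new b b<1+t with b Fin.≟ a
    ... | yes b≡a = i , Di , refl
    ... | no b≢a  = old b (ℕ.≤∧≢⇒< (ℕ.≤-pred b<1+t)
                      (λ b≡t → b≢a (Fin.toℕ-injective (trans b≡t (sym (Fin.toℕ-fromℕ< t<r))))))
  ...   | inj₂ none = inj₁ (y , y≢0 , λ i Di → decidable-stable (dot y (V i) ≟ 0ℚ) (λ ≢0 → none i (Di , ≢0)))
    where
    a = fromℕ< t<r
    y = dual B a
    y≢0 : ∃ λ c → y c ≢ 0ℚ
    y≢0 with nonzero⊎zero y
    ... | inj₁ p = p
    ... | inj₂ z = ⊥-elim (1≢0 (trans (sym (trans (dual-δ B a a) (δ-refl a))) (dot-zeroˡ (w a) z)))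
... | inj₁ ann = inj₁ ann
... | inj₂ (w , B , p) = inj₂ ((λ a → proj₁ (p a (Fin.toℕ<n a))) , (λ a → proj₁ (proj₂ (p a (Fin.toℕ<n a)))) ,
                          Basis-cong (λ a → ≡⇒≈ (proj₂ (proj₂ (p a (Fin.toℕ<n a))))) B)

-- Linear dependence and annihilators

dependent : ∀ r (v : Fin (suc r) → Pt r) →
            Σ (Fin (suc r) → ℚ) λ c → (∃ λ j → c j ≢ 0ℚ) × (∀ a → Σℚ (λ j → c j * v j a) ≡ 0ℚ)
dependent r v with nonzero⊎zero (v zero)
... | inj₂ v₀≡0 = δ zero , (zero , 1≢0) , λ a → trans (Σ-δˡ zero (λ j → v j a)) (v₀≡0 a)
-- Gaussian elimination: coordinate `a`, where the first vector is nonzero, is cleared from the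
-- other vectors and dropped, and recursion finds a dependence among these.
dependent (suc r) v | inj₁ (a , v₀a≢0) = c , (suc j , c′j≢0) , relation
  where
  open ≡-Reasoning
  s : ℚ
  s = proj₁ (inverse v₀a≢0)
  reduced : Fin (suc r) → Pt (suc r)
  reduced j e = v (suc j) e - (v (suc j) a * s) * v zero e
  IH = dependent r (λ j b → reduced j (punchIn a b))
  c′ = proj₁ IH
  j = proj₁ (proj₁ (proj₂ IH))
  c′j≢0 = proj₂ (proj₁ (proj₂ IH))
  c : Fin (suc (suc r)) → ℚ
  -- Gathers the multiples of `v zero` subtracted in `reduced`.
  c zero    = - Σℚ (λ j → c′ j * (v (suc j) a * s))
  c (suc j) = c′ j
  lemma₁ : ∀ c x y z → c * (x - y * z) ≡ c * x - (c * y) * z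
  lemma₁ = solve-∀ ℚ-ring
  lemma₂ : ∀ p q → - p + q ≡ q - p
  lemma₂ = solve-∀ ℚ-ring
  lemma₃ : ∀ x s z → x - (x * s) * z ≡ x - x * (s * z)
  lemma₃ = solve-∀ ℚ-ring
  lemma₄ : ∀ x → x - x * 1ℚ ≡ 0ℚ
  lemma₄ = solve-∀ ℚ-ring
  combine : ∀ e → Σℚ (λ j → c j * v j e) ≡ Σℚ (λ j → c′ j * reduced j e)
  combine e = begin
    - S * v zero e + T
      ≡⟨ cong (_+ T) (sym (neg-distribˡ-* S (v zero e))) ⟩
    - (S * v zero e) + T
      ≡⟨ lemma₂ (S * v zero e) T ⟩
    T - S * v zero e
      ≡⟨ cong (λ q → T - q) (sym (Σ-*ʳ (v zero e) (λ j → c′ j * (v (suc j) a * s)))) ⟩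
    T - Σℚ (λ j → (c′ j * (v (suc j) a * s)) * v zero e)
      ≡⟨ sym (Σ-- (λ j → c′ j * v (suc j) e) (λ j → (c′ j * (v (suc j) a * s)) * v zero e)) ⟩
    Σℚ (λ j → c′ j * v (suc j) e - (c′ j * (v (suc j) a * s)) * v zero e)
      ≡⟨ Σ-cong (λ j → sym (lemma₁ (c′ j) (v (suc j) e) (v (suc j) a * s) (v zero e))) ⟩
    Σℚ (λ j → c′ j * reduced j e) ∎
    where
    S = Σℚ (λ j → c′ j * (v (suc j) a * s))
    T = Σℚ (λ j → c′ j * v (suc j) e)
  relation : ∀ e → Σℚ (λ j → c j * v j e) ≡ 0ℚ
  relation e with a Fin.≟ e
  ... | yes refl = trans (combine a) (Σ-zero (λ j → *-zeroʳ-≡ (c′ j)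
        (trans (lemma₃ (v (suc j) a) s (v zero a))
          (trans (cong (λ q → v (suc j) a - v (suc j) a * q) (proj₂ (inverse v₀a≢0))) (lemma₄ (v (suc j) a))))))
  ... | no a≢e = subst (λ e → Σℚ (λ j → c j * v j e) ≡ 0ℚ) (Fin.punchIn-punchOut a≢e)
        (trans (combine (punchIn a (punchOut a≢e))) (proj₂ (proj₂ IH) (punchOut a≢e)))

-- If `y a` were nonzero, the vectors with coordinate `a` dropped would be too many for their space,
-- so some nontrivial combination `z` is supported at `a` alone. As `y` annihilates `z`, also `z a`
-- vanishes, against independence.
annihilator-zero : {v : Fin r → Pt r} → LinIndep v → (y : Pt r) → (∀ j → dot y (v j) ≡ 0ℚ) → ∀ a → y a ≡ 0ℚ
annihilator-zero {r} {v} indep y yv≡0 with nonzero⊎zero y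
... | inj₂ y≡0 = y≡0
annihilator-zero {suc r} {v} indep y yv≡0 | inj₁ (a , ya≢0) = ⊥-elim (c≢0 (indep c z≡0 j))
  where
  dep = dependent r (λ j b → v j (punchIn a b))
  c = proj₁ dep
  j = proj₁ (proj₁ (proj₂ dep))
  c≢0 = proj₂ (proj₁ (proj₂ dep))
  z : Pt (suc r)
  z e = Σℚ (λ j → c j * v j e)
  z-off : ∀ e → e ≢ a → z e ≡ 0ℚ
  z-off e e≢a = subst (λ e → z e ≡ 0ℚ) (Fin.punchIn-punchOut (e≢a ∘ sym)) (proj₂ (proj₂ dep) (punchOut (e≢a ∘ sym)))
  za*ya≡0 : z a * y a ≡ 0ℚ
  za*ya≡0 = trans (*-comm (z a) (y a)) (trans (sym (Σ-single a (λ e e≢a → *-zeroʳ-≡ (y e) (z-off e e≢a))))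
              (trans (dot-Σʳ y c v) (Σ-zero (λ j → *-zeroʳ-≡ (c j) (yv≡0 j)))))
  z≡0 : ∀ e → z e ≡ 0ℚ
  z≡0 e with e Fin.≟ a
  ... | yes refl = *-cancelʳ-≡0 ya≢0 za*ya≡0
  ... | no e≢a   = z-off e e≢a

-- Convex hulls

module _ {V : Pt r → Set} where

  Conv-point : ∀ {v} → V v → Conv V v
  Conv-point {v} Vv = 1 , (λ _ → v) , (λ _ → 1ℚ) , (λ _ → Vv) , (λ _ → ≤ᵇ⇒≤ _) , refl ,
    λ a → sym (trans (+-identityʳ (1ℚ * v a)) (*-identityˡ (v a)))

  Conv-resp : ∀ {x y} → x ≈ y → Conv V x → Conv V y
  Conv-resp x≈y (k , p , λ′ , Vp , 0≤λ , Σλ , x≡) = k , p , λ′ , Vp , 0≤λ , Σλ , λ a → trans (sym (x≈y a)) (x≡ a)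

  Conv-map : {W : Pt r → Set} → (∀ {v} → V v → W v) → ∀ {x} → Conv V x → Conv W x
  Conv-map V⊆W (k , p , λ′ , Vp , rest) = k , p , λ′ , (λ j → V⊆W (Vp j)) , rest

  dot-Conv : ∀ c {x} ((k , p , λ′ , _) : Conv V x) → dot c x ≡ Σℚ (λ j → λ′ j * dot c (p j))
  dot-Conv c (k , p , λ′ , _ , _ , _ , x≡) = trans (dot-cong {x = c} (λ _ → refl) x≡) (dot-Σʳ c λ′ p)

  weights : ∀ b {x} ((k , p , λ′ , _) : Conv V x) → Σℚ (λ j → λ′ j * b) ≡ b
  weights b (k , p , λ′ , _ , _ , Σλ , _) = trans (Σ-*ʳ b λ′) (trans (cong (_* b) Σλ) (*-identityˡ b))

  Conv-≤ : ∀ c {b} → (∀ {v} → V v → dot c v ≤ b) → ∀ {x} → Conv V x → dot c x ≤ b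
  Conv-≤ c {b} V≤b C@(k , p , λ′ , Vp , 0≤λ , _) = subst₂ _≤_ (sym (dot-Conv c C)) (weights b C)
    (Σ-mono-≤ (λ j → *-monoˡ-≤-nonNeg (λ′ j) {{nonNegative (0≤λ j)}} (V≤b (Vp j))))

  Conv-≡ : ∀ c {b} → (∀ {v} → V v → dot c v ≡ b) → ∀ {x} → Conv V x → dot c x ≡ b
  Conv-≡ c {b} V≡b C@(k , p , λ′ , Vp , _) = trans (dot-Conv c C) (trans (Σ-cong (λ j → cong (λ′ j *_) (V≡b (Vp j)))) (weights b C))

  Conv-≈ : ∀ {v} → (∀ {p} → V p → p ≈ v) → ∀ {x} → Conv V x → x ≈ v
  Conv-≈ {v} V≈v C@(k , p , λ′ , Vp , _ , _ , x≡) a =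
    trans (x≡ a) (trans (Σ-cong (λ j → cong (λ′ j *_) (V≈v (Vp j) a))) (weights (v a) C))

  -- Only points of zero weight lie off the face; they are replaced by a point of nonzero weight.
  Conv-face : ∀ c {b} → (∀ {v} → V v → dot c v ≤ b) → ∀ {x} → Conv V x → dot c x ≡ b →
              Conv (λ v → V v × dot c v ≡ b) x
  Conv-face c {b} V≤b {x} C@(k , p , λ′ , Vp , 0≤λ , Σλ , x≡) cx≡b =
    k , p′ , λ′ , p′-face , 0≤λ , Σλ , λ a → trans (x≡ a) (Σ-cong (λ j → p′-same j a))
    where
    open ≡-Reasoning
    lemma : ∀ l b d → l * (b - d) ≡ l * b - l * d
    lemma = solve-∀ ℚ-ring
    slack≡0 : ∀ j → λ′ j * (b - dot c (p j)) ≡ 0ℚ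
    slack≡0 = Σ≡0⇒≡0 (λ j → *-nonNeg (0≤λ j) (0≤q-p (V≤b (Vp j)))) (begin
      Σℚ (λ j → λ′ j * (b - dot c (p j)))
        ≡⟨ Σ-cong (λ j → lemma (λ′ j) b (dot c (p j))) ⟩
      Σℚ (λ j → λ′ j * b - λ′ j * dot c (p j))
        ≡⟨ Σ-- (λ j → λ′ j * b) (λ j → λ′ j * dot c (p j)) ⟩
      Σℚ (λ j → λ′ j * b) - Σℚ (λ j → λ′ j * dot c (p j))
        ≡⟨ cong₂ _-_ (weights b C) (trans (sym (dot-Conv c C)) cx≡b) ⟩
      b - b
        ≡⟨ +-inverseʳ b ⟩
      0ℚ ∎)
    on-face : ∀ j → λ′ j ≢ 0ℚ → dot c (p j) ≡ b
    on-face j λ≢0 = sym (p-q≡0⇒p≡q (*-cancelʳ-≡0 λ≢0 (trans (*-comm (b - dot c (p j)) (λ′ j)) (slack≡0 j))))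
    support : ∃ λ j → λ′ j ≢ 0ℚ
    support with nonzero⊎zero λ′
    ... | inj₁ s = s
    ... | inj₂ z = ⊥-elim (1≢0 (trans (sym Σλ) (Σ-zero z)))
    p′ : Fin k → Pt r
    p′ j with λ′ j ≟ 0ℚ
    ... | yes _ = p (proj₁ support)
    ... | no  _ = p j
    p′-face : ∀ j → V (p′ j) × dot c (p′ j) ≡ b
    p′-face j with λ′ j ≟ 0ℚ
    ... | yes _   = Vp (proj₁ support) , on-face (proj₁ support) (proj₂ support)
    ... | no  λ≢0 = Vp j , on-face j λ≢0
    p′-same : ∀ j a → λ′ j * p j a ≡ λ′ j * p′ j a
    p′-same j a with λ′ j ≟ 0ℚ
    ... | yes λ≡0 = trans (*-zeroˡ-≡ (p j a) λ≡0) (sym (*-zeroˡ-≡ (p (proj₁ support) a) λ≡0))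
    ... | no  _   = refl

  Conv-inhabited : ∀ {x} → Conv V x → ∃ V
  Conv-inhabited (zero  , _ , _ , _ , _ , () , _)
  Conv-inhabited (suc k , p , _ , Vp , _) = p zero , Vp zero

module _ {V : Pt r → Set} where

  -- A point on the supporting hyperplane is a combination of generators on that hyperplane. At
  -- least one such generator exists, and it lies in the face, which is only `v`.
  vertex⇒generator : ∀ {v} → IsVertex (Conv V) v → ∃ λ p → V p × p ≈ v
  vertex⇒generator {v} (c , b , P≤b , face) with proj₁ (face v) (λ _ → refl)
  ... | Pv , cv≡b with Conv-inhabited {V = λ p → V p × dot c p ≡ b} (Conv-face {V = V} c (λ {v} Vv → P≤b v (Conv-point {V = V} Vv)) Pv cv≡b)
  ...   | p , Vp , cp≡b = p , Vp , proj₂ (face p) (Conv-point {V = V} Vp , cp≡b)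

  exposed⇒vertex : ∀ c {b v} → V v → dot c v ≡ b → (∀ {p} → V p → (p ≈ v) ⊎ (dot c p < b)) → IsVertex (Conv V) v
  exposed⇒vertex c {b} {v} Vv cv≡b exposed = c , b , (λ x → Conv-≤ {V = V} c V≤b) , λ x →
    (λ x≈v → Conv-resp {V = V} (λ a → sym (x≈v a)) (Conv-point {V = V} Vv) , trans (dot-cong {x = c} (λ _ → refl) x≈v) cv≡b) ,
    (λ (Px , cx≡b) → Conv-≈ unique (Conv-face {V = V} c V≤b Px cx≡b))
    where
    V≤b : ∀ {p} → V p → dot c p ≤ b
    V≤b Vp with exposed Vp
    ... | inj₁ p≈v  = ≤-reflexive (trans (dot-cong {x = c} (λ _ → refl) p≈v) cv≡b)
    ... | inj₂ cp<b = <⇒≤ cp<b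
    unique : ∀ {p} → V p × dot c p ≡ b → p ≈ v
    unique (Vp , cp≡b) with exposed Vp
    ... | inj₁ p≈v  = p≈v
    ... | inj₂ cp<b = ⊥-elim (<⇒≢ cp<b cp≡b)

dot-Σˡ : (f : Fin k → Pt r) (x : Pt r) → dot (λ a → Σℚ (λ j → f j a)) x ≡ Σℚ (λ j → dot (f j) x)
dot-Σˡ f x = trans (Σ-cong (λ a → sym (Σ-*ʳ (x a) (λ j → f j a)))) (Σ-swap (λ a j → f j a * x a))

-- Weakly unimodular matrices

module FullRankWU {r n : ℕ} (M : Mat r n) (wu : IsFullRankWU M) where

  ColBasis : (Fin r → Fin n) → Set
  ColBasis σ = Basis (λ j → col M (σ j))

  no-annihilator : (y : Pt r) → (∀ i → dot y (col M i) ≡ 0ℚ) → ∀ a → y a ≡ 0ℚ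
  no-annihilator y y≡0 = annihilator-zero (proj₂ (proj₁ wu)) y (λ j → y≡0 (proj₁ (proj₁ wu) j))

  Trit-Det : ∀ σ → Trit (Det (λ j → col M (σ j)))
  Trit-Det σ = subst Trit (Det-ι (λ a j → M a (σ j))) (Tritℤ⇒Trit (proj₂ wu σ))

  Unit-Det : ∀ {σ} → ColBasis σ → Unit (Det (λ j → col M (σ j)))
  Unit-Det {σ} B = Trit∧≢0⇒Unit (Trit-Det σ) (det≢0 B)

  -- `d * d ≡ 1`, so multiplying by `d` divides by it; `d` is the denominator in Cramer's rule.
  solve-Unit : ∀ {p q d} → Unit d → p ≡ q * d → q ≡ p * d
  solve-Unit {p} {q} {d} u p≡qd = begin
    q             ≡⟨ sym (*-identityʳ q) ⟩
    q * 1ℚ        ≡⟨ cong (q *_) (sym (Unit-* u)) ⟩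
    q * (d * d)   ≡⟨ sym (*-assoc q d d) ⟩
    (q * d) * d   ≡⟨ cong (_* d) (sym p≡qd) ⟩
    p * d         ∎
    where open ≡-Reasoning

  -- By Cramer's rule the coordinate is the minor of `σ [ a ≔ i ]` divided by the minor of `σ`; the
  -- former is 0 or ±1, the latter ±1.
  Trit-dual : ∀ {σ} (B : ColBasis σ) a i → Trit (dot (dual B a) (col M i))
  Trit-dual {σ} B a i = subst Trit (sym (solve-Unit (Unit-Det {σ} B)
      (cramer {w′ = λ j → col M ((σ [ a ≔ i ]) j)} B a (col M i)
        (λ b b≢a → ≡⇒≈ (cong (col M) (≔-off σ i b≢a))) (≡⇒≈ (cong (col M) (≔-at σ a i))))))
    (Trit*Unit (Trit-Det (σ [ a ≔ i ])) (Unit-Det {σ} B))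

  -- The entry at `b` is the value of the dual vector at the standard vector `δ b`. Cramer's
  -- numerator is then an integer determinant, though in general not a minor of `M`.
  IsInt-dual : ∀ {σ} (B : ColBasis σ) a b → IsInt (dual B a b)
  IsInt-dual {σ} B a b = subst IsInt
    (trans (sym (solve-Unit (Unit-Det {σ} B) (cramer B a (δ b) (λ j j≢a → ≡⇒≈ (≔-off w (δ b) j≢a)) (≡⇒≈ (≔-at w a (δ b))))))
      (trans (dot-comm (dual B a) (δ b)) (Σ-δˡ b (dual B a))))
    (IsInt-* (IsInt-Det int) (Unit⇒Int (Unit-Det {σ} B)))
    where
    w : Fin r → Pt r
    w j = col M (σ j)
    int : ∀ j c → IsInt ((w [ a ≔ δ b ]) j c)
    int j c with j Fin.≟ a
    ... | yes _ = IsInt-δ b c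
    ... | no  _ = M c (σ j) , refl

  exchange-col : ∀ {σ} (B : ColBasis σ) a i → dot (dual B a) (col M i) ≢ 0ℚ → ColBasis (σ [ a ≔ i ])
  exchange-col {σ} B a i ≢0 = exchange B a (col M i) ≢0
    (λ b b≢a → ≡⇒≈ (cong (col M) (≔-off σ i b≢a))) (≡⇒≈ (cong (col M) (≔-at σ a i)))

  some-basis : Σ (Fin r → Fin n) ColBasis
  some-basis with annihilated⊎basis (col M) {λ _ → ⊤} (λ _ → yes tt)
  ... | inj₁ (y , (a , ya≢0) , y≡0) = ⊥-elim (ya≢0 (no-annihilator y (λ i → y≡0 i tt) a))
  ... | inj₂ (σ , _ , B)            = σ , B

-- Simplicity: columns as vertices, and `Fu` as a face

module SimpleWU {r n : ℕ} (M : Mat r n) (wu : IsFullRankWU M) (simple : IsSimple M) where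

  open FullRankWU M wu

  no-loop : ∀ i → ¬ (∀ c → col M i c ≡ 0ℚ)
  no-loop i Mi≡0 = 1≢0 (trans (sym (δ-refl i)) (simple i i (δ i)
    (λ k k∉ → δ-≢ (λ i≡k → k∉ (inj₁ (sym i≡k)))) (λ c → trans (Σ-δˡ i (λ k → col M k c)) (Mi≡0 c)) i))

  -- Otherwise `δ j - t * δ i` would give a relation supported on `i` and `j`. Consequently, in a
  -- basis containing `i`, column `j` has a nonzero coordinate at some other member, where it can be
  -- exchanged in while `i` stays.
  no-parallel : ∀ {i j} t → j ≢ i → ¬ (∀ c → col M j c ≡ t * col M i c)
  no-parallel {i} {j} t j≢i Mj≡tMi = 1≢0 (trans (sym at-j) (simple i j coeff outside relation j))
    where
    open ≡-Reasoning
    coeff : Fin n → ℚ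
    coeff k = δ j k - t * δ i k
    lemma₁ : ∀ t → 1ℚ - t * 0ℚ ≡ 1ℚ
    lemma₁ = solve-∀ ℚ-ring
    lemma₂ : ∀ t → 0ℚ - t * 0ℚ ≡ 0ℚ
    lemma₂ = solve-∀ ℚ-ring
    lemma₃ : ∀ t d e x → (d - t * e) * x ≡ d * x - t * (e * x)
    lemma₃ = solve-∀ ℚ-ring
    at-j : coeff j ≡ 1ℚ
    at-j = trans (cong₂ (λ p q → p - t * q) (δ-refl j) (δ-≢ (j≢i ∘ sym))) (lemma₁ t)
    outside : ∀ k → ¬ ((k ≡ i) ⊎ (k ≡ j)) → coeff k ≡ 0ℚ
    outside k k∉ = trans (cong₂ (λ p q → p - t * q) (δ-≢ (λ eq → k∉ (inj₂ (sym eq)))) (δ-≢ (λ eq → k∉ (inj₁ (sym eq))))) (lemma₂ t)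
    relation : ∀ c → Σℚ (λ k → coeff k * col M k c) ≡ 0ℚ
    relation c = begin
      Σℚ (λ k → coeff k * col M k c)
        ≡⟨ Σ-cong (λ k → lemma₃ t (δ j k) (δ i k) (col M k c)) ⟩
      Σℚ (λ k → δ j k * col M k c - t * (δ i k * col M k c))
        ≡⟨ Σ-- (λ k → δ j k * col M k c) (λ k → t * (δ i k * col M k c)) ⟩
      Σℚ (λ k → δ j k * col M k c) - Σℚ (λ k → t * (δ i k * col M k c))
        ≡⟨ cong₂ _-_ (trans (Σ-δˡ j (λ k → col M k c)) (Mj≡tMi c))
             (trans (Σ-*ˡ t (λ k → δ i k * col M k c)) (cong (t *_) (Σ-δˡ i (λ k → col M k c)))) ⟩
      t * col M i c - t * col M i c
        ≡⟨ +-inverseʳ (t * col M i c) ⟩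
      0ℚ ∎

  -- A nonzero column has a nonzero coordinate, at which it can be exchanged in.
  basis-through : ∀ i → Σ (Fin r → Fin n) λ σ → ColBasis σ × ∃ λ a → σ a ≡ i
  basis-through i with some-basis
  ... | σ , B with nonzero⊎zero (λ a → dot (dual B a) (col M i))
  ...   | inj₁ (a , ≢0) = σ [ a ≔ i ] , exchange-col B a i ≢0 , a , ≔-at σ a i
  ...   | inj₂ ≡0       = ⊥-elim (no-loop i (λ c → trans (expand B (col M i) c)
                            (Σ-zero (λ a → *-zeroˡ-≡ (col M (σ a) c) (≡0 a)))))

  -- The last clause is conditional so that every `j`, including `i` itself, has such a functional
  -- and the sum can run over all of `Fin n`.
  Separates : Fin n → Fin n → Pt r → Set
  Separates i j f = (dot f (col M i) ≡ 1ℚ) × (∀ k → Trit (dot f (col M k))) × (j ≢ i → dot f (col M j) ≡ 0ℚ)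

  -- A coordinate functional of a basis containing both i and j.
  separate : ∀ i j → ∃ (Separates i j)
  separate i j with basis-through i
  ... | σ , B , a , refl with j Fin.≟ σ a
  ...   | yes j≡i = dual B a , trans (dual-δ B a a) (δ-refl a) , Trit-dual B a , λ j≢i → ⊥-elim (j≢i j≡i)
  ...   | no j≢i with any⊎all (λ b → ¬? (b Fin.≟ a) ×-dec ¬? (dot (dual B b) (col M j) ≟ 0ℚ))
  ...     | inj₂ none = ⊥-elim (no-parallel (dot (dual B a) (col M j)) j≢i (λ c → trans (expand B (col M j) c)
              (Σ-single a (λ b b≢a → *-zeroˡ-≡ (col M (σ b) c)
                (decidable-stable (dot (dual B b) (col M j) ≟ 0ℚ) (λ ≢0 → none b (b≢a , ≢0)))))))
  ...     | inj₁ (b , b≢a , ≢0) = dual B′ a ,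
              trans (cong (λ k → dot (dual B′ a) (col M k)) (sym (≔-off σ j (b≢a ∘ sym)))) (trans (dual-δ B′ a a) (δ-refl a)) ,
              Trit-dual B′ a ,
              λ _ → trans (cong (λ k → dot (dual B′ a) (col M k)) (sym (≔-at σ b j))) (trans (dual-δ B′ a b) (δ-≢ (b≢a ∘ sym)))
    where B′ = exchange-col B b j ≢0

  Generator : Pt r → Set
  Generator v = ∃ λ (i : Fin n) → (v ≈ col M i) ⊎ (v ≈ (λ a → - col M i a))

  Generator-neg : ∀ {v} → Generator v → Generator (λ a → - v a)
  Generator-neg (i , inj₁ v≈) = i , inj₂ (λ a → cong -_ (v≈ a))
  Generator-neg (i , inj₂ v≈) = i , inj₁ (λ a → trans (cong -_ (v≈ a)) (neg-involutive (col M i a)))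

  -- Summing the separating functionals over all j exposes column i.
  module _ (i : Fin n) where

    private
      f : Fin n → Pt r
      f j = proj₁ (separate i j)

      f-col : ∀ k j → Trit (dot (f j) (col M k))
      f-col k j = proj₁ (proj₂ (proj₂ (separate i j))) k

    exposing : Pt r
    exposing a = Σℚ (λ j → f j a)

    exposing-value : ℚ
    exposing-value = Σℚ {n} (λ _ → 1ℚ)

    exposing-at : dot exposing (col M i) ≡ exposing-value
    exposing-at = trans (dot-Σˡ f (col M i)) (Σ-cong (λ j → proj₁ (proj₂ (separate i j))))

    exposing-< : ∀ {x} → (∀ j → Trit (dot (f j) x)) → ∀ j → dot (f j) x < 1ℚ → dot exposing x < exposing-value
    exposing-< {x} trit j <1 = subst (_< exposing-value) (sym (dot-Σˡ f x)) (Σ-mono-< (λ j → Trit⇒≤1 (trit j)) j <1)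

    exposed : ∀ {p} → Generator p → (p ≈ col M i) ⊎ (dot exposing p < exposing-value)
    exposed {p} (k , sign) with k Fin.≟ i
    exposed {p} (k , inj₁ p≈) | yes refl = inj₁ p≈
    exposed {p} (k , inj₂ p≈) | yes refl = inj₂ (subst (_< exposing-value) (sym (dot-cong {x = exposing} (λ _ → refl) p≈))
      (exposing-< (λ j → subst Trit (sym (dot-negʳ (f j) (col M i))) (Trit-neg (f-col i j))) i
        (subst (_< 1ℚ) (sym (trans (dot-negʳ (f i) (col M i)) (cong -_ (proj₁ (proj₂ (separate i i)))))) -1<1)))
    exposed {p} (k , inj₁ p≈) | no k≢i = inj₂ (subst (_< exposing-value) (sym (dot-cong {x = exposing} (λ _ → refl) p≈))
      (exposing-< (f-col k) k (subst (_< 1ℚ) (sym (proj₂ (proj₂ (proj₂ (separate i k))) k≢i)) 0<1)))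
    exposed {p} (k , inj₂ p≈) | no k≢i = inj₂ (subst (_< exposing-value) (sym (dot-cong {x = exposing} (λ _ → refl) p≈))
      (exposing-< (λ j → subst Trit (sym (dot-negʳ (f j) (col M k))) (Trit-neg (f-col k j))) k
        (subst (_< 1ℚ) (sym (trans (dot-negʳ (f k) (col M k)) (cong -_ (proj₂ (proj₂ (proj₂ (separate i k))) k≢i)))) 0<1)))

  generator⇒vertex : ∀ {v} → Generator v → IsVertex (PM M) v
  generator⇒vertex {v} Gv@(i , inj₁ v≈) = exposed⇒vertex (exposing i) Gv
    (trans (dot-cong {x = exposing i} (λ _ → refl) v≈) (exposing-at i)) λ Gp → case exposed i Gp of λ where
      (inj₁ p≈) → inj₁ (λ a → trans (p≈ a) (sym (v≈ a)))
      (inj₂ lt) → inj₂ lt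
  -- The generators are symmetric about the origin: negating the functional that exposes column `i`
  -- exposes its negative.
  generator⇒vertex {v} Gv@(i , inj₂ v≈) = exposed⇒vertex c Gv cv≡ λ {p} Gp → case exposed i (Generator-neg Gp) of λ where
      (inj₁ p≈) → inj₁ (λ a → trans (sym (neg-involutive (p a))) (trans (cong -_ (p≈ a)) (sym (v≈ a))))
      (inj₂ lt) → inj₂ (subst (_< exposing-value i) (trans (dot-negʳ (exposing i) p) (sym (dot-negˡ (exposing i) p))) lt)
    where
    open ≡-Reasoning
    c : Pt r
    c a = - exposing i a
    cv≡ : dot c v ≡ exposing-value i
    cv≡ = begin
      dot c v                                     ≡⟨ dot-cong {x = c} (λ _ → refl) v≈ ⟩
      dot c (λ a → - col M i a)                   ≡⟨ dot-negʳ c (col M i) ⟩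
      - dot c (col M i)                           ≡⟨ cong -_ (dot-negˡ (exposing i) (col M i)) ⟩
      - (- dot (exposing i) (col M i))            ≡⟨ neg-involutive _ ⟩
      dot (exposing i) (col M i)                  ≡⟨ exposing-at i ⟩
      exposing-value i                            ∎

  FuVertex : (Fin r → ℤ) → Pt r → Set
  FuVertex u v = IsVertex (PM M) v × (dot v (ι ∘ u) ≡ 1ℚ)

  -- Generators and vertices are the same points, so both sides are hulls of the generators with
  -- value 1. For the face this holds because no generator of smaller value can carry weight.
  Fu-face : (u : Fin r → ℤ) → InPolar M u → Fu M u ≐ (λ x → PM M x × (dot (ι ∘ u) x ≡ 1ℚ))
  Fu-face u polar x = to , from
    where
    from : PM M x × (dot (ι ∘ u) x ≡ 1ℚ) → Fu M u x
    from (Px , ux≡1) = Conv-map {V = λ v → Generator v × (dot (ι ∘ u) v ≡ 1ℚ)} {W = FuVertex u}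
      (λ {v} (Gv , uv≡1) → generator⇒vertex Gv , trans (dot-comm v (ι ∘ u)) uv≡1)
      (Conv-face {V = Generator} (ι ∘ u) (λ {v} Gv → polar v (Conv-point {V = Generator} Gv)) Px ux≡1)
    gen : ∀ {v} → FuVertex u v → Generator v
    gen (vert , _) with vertex⇒generator {V = Generator} vert
    ... | p , (i , inj₁ p≈) , p≈v = i , inj₁ (λ a → trans (sym (p≈v a)) (p≈ a))
    ... | p , (i , inj₂ p≈) , p≈v = i , inj₂ (λ a → trans (sym (p≈v a)) (p≈ a))
    to : Fu M u x → PM M x × (dot (ι ∘ u) x ≡ 1ℚ)
    to Fx = Conv-map {V = FuVertex u} gen Fx ,
            Conv-≡ {V = FuVertex u} (ι ∘ u) (λ {v} (_ , vu≡1) → trans (dot-comm (ι ∘ u) v) vu≡1) Fx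

-- Dimension of faces

-- A relation among the differences is one among the points, with `- Σℚ c` as the coefficient of
-- `p zero`.
LinIndep⇒AffIndep : {p : Fin (suc k) → Pt r} → LinIndep p → AffIndep p
LinIndep⇒AffIndep {k} {r} {p} indep c rel j = indep C relation (suc j)
  where
  open ≡-Reasoning
  C : Fin (suc k) → ℚ
  C zero    = - Σℚ c
  C (suc j) = c j
  lemma₁ : ∀ S p T → - S * p + T ≡ T - S * p
  lemma₁ = solve-∀ ℚ-ring
  lemma₂ : ∀ c x y → c * x - c * y ≡ c * (x - y)
  lemma₂ = solve-∀ ℚ-ring
  relation : ∀ a → Σℚ (λ j → C j * p j a) ≡ 0ℚ
  relation a = begin
    - Σℚ c * p zero a + Σℚ (λ j → c j * p (suc j) a)
      ≡⟨ lemma₁ (Σℚ c) (p zero a) (Σℚ (λ j → c j * p (suc j) a)) ⟩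
    Σℚ (λ j → c j * p (suc j) a) - Σℚ c * p zero a
      ≡⟨ cong (λ q → Σℚ (λ j → c j * p (suc j) a) - q) (sym (Σ-*ʳ (p zero a) c)) ⟩
    Σℚ (λ j → c j * p (suc j) a) - Σℚ (λ j → c j * p zero a)
      ≡⟨ sym (Σ-- (λ j → c j * p (suc j) a) (λ j → c j * p zero a)) ⟩
    Σℚ (λ j → c j * p (suc j) a - c j * p zero a)
      ≡⟨ Σ-cong (λ j → lemma₂ (c j) (p (suc j) a) (p zero a)) ⟩
    Σℚ (λ j → c j * (p (suc j) a - p zero a))
      ≡⟨ rel a ⟩
    0ℚ ∎

-- Applying `u` to a relation shows that its coefficients sum to zero, so it is a relation among the
-- differences from `p zero`.
AffIndep⇒LinIndep : {p : Fin (suc k) → Pt r} (u : Pt r) → (∀ j → dot u (p j) ≡ 1ℚ) → AffIndep p → LinIndep p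
AffIndep⇒LinIndep {k} {r} {p} u up≡1 indep c rel = λ where
    zero    → trans c₀≡ (cong -_ (Σ-zero c₊≡0))
    (suc j) → c₊≡0 j
  where
  open ≡-Reasoning
  c₊ : Fin k → ℚ
  c₊ j = c (suc j)
  total : c zero + Σℚ c₊ ≡ 0ℚ
  total = trans (Σ-cong (λ j → trans (sym (*-identityʳ (c j))) (cong (c j *_) (sym (up≡1 j))))) (dot-relation u c p rel)
  lemma₁ : ∀ x y → x ≡ (x + y) - y
  lemma₁ = solve-∀ ℚ-ring
  lemma₂ : ∀ c x y → c * (x - y) ≡ c * x - c * y
  lemma₂ = solve-∀ ℚ-ring
  lemma₃ : ∀ T S p → T - S * p ≡ - S * p + T
  lemma₃ = solve-∀ ℚ-ring
  c₀≡ : c zero ≡ - Σℚ c₊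
  c₀≡ = trans (lemma₁ (c zero) (Σℚ c₊)) (trans (cong (_- Σℚ c₊) total) (+-identityˡ (- Σℚ c₊)))
  c₊≡0 : ∀ j → c₊ j ≡ 0ℚ
  c₊≡0 = indep c₊ (λ a → begin
    Σℚ (λ j → c₊ j * (p (suc j) a - p zero a))
      ≡⟨ Σ-cong (λ j → lemma₂ (c₊ j) (p (suc j) a) (p zero a)) ⟩
    Σℚ (λ j → c₊ j * p (suc j) a - c₊ j * p zero a)
      ≡⟨ Σ-- (λ j → c₊ j * p (suc j) a) (λ j → c₊ j * p zero a) ⟩
    Σℚ (λ j → c₊ j * p (suc j) a) - Σℚ (λ j → c₊ j * p zero a)
      ≡⟨ cong (λ q → Σℚ (λ j → c₊ j * p (suc j) a) - q) (Σ-*ʳ (p zero a) c₊) ⟩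
    Σℚ (λ j → c₊ j * p (suc j) a) - Σℚ c₊ * p zero a
      ≡⟨ lemma₃ (Σℚ (λ j → c₊ j * p (suc j) a)) (Σℚ c₊) (p zero a) ⟩
    - Σℚ c₊ * p zero a + Σℚ (λ j → c₊ j * p (suc j) a)
      ≡⟨ cong (λ q → q * p zero a + Σℚ (λ j → c₊ j * p (suc j) a)) (sym c₀≡) ⟩
    c zero * p zero a + Σℚ (λ j → c₊ j * p (suc j) a)
      ≡⟨ rel a ⟩
    0ℚ ∎)

-- The `r` independent differences would all be annihilated by `u`, forcing `u` to be zero, against
-- its value 1 on the points. This bounds the dimension of a facet from above.
hyperplane-dim< : (u : Pt r) {p : Fin (suc r) → Pt r} → (∀ j → dot u (p j) ≡ 1ℚ) → ¬ AffIndep p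
hyperplane-dim< u {p} up≡1 indep = 1≢0 (trans (sym (up≡1 zero)) (dot-zeroˡ (p zero) (annihilator-zero indep u u⊥)))
  where
  u⊥ : ∀ j → dot u (λ a → p (suc j) a - p zero a) ≡ 0ℚ
  u⊥ j = trans (dot-sub u (p (suc j)) (p zero)) (cong₂ _-_ (up≡1 (suc j)) (up≡1 zero))

transp·-dot : (M : Mat r n) (u : Fin r → ℤ) (i : Fin n) → dot (ι ∘ u) (col M i) ≡ ι (transp· M u i)
transp·-dot M u i = sym (trans (Σ-ι (λ a → M a i ℤ.* u a))
  (Σ-cong (λ a → trans (ι-* (M a i) (u a)) (*-comm (ι (M a i)) (ι (u a))))))

-- Bases of the matroid

module MatroidBases {r n : ℕ} (M : Mat r n) (wu : IsFullRankWU M) where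

  open FullRankWU M wu

  Image : (Fin r → Fin n) → Fin n → Set
  Image σ i = ∃ λ a → σ a ≡ i

  Image? : ∀ σ i → Dec (Image σ i)
  Image? σ i = Fin.any? (λ a → σ a Fin.≟ i)

  -- The functional `dual B a` vanishes on all other members of the image, so it isolates the
  -- coefficient at `σ a`.
  Image-indep : ∀ {σ} → ColBasis σ → IndepCols M (Image σ)
  Image-indep {σ} B c outside rel i with Image? σ i
  ... | no i∉          = outside i i∉
  ... | yes (a , refl) = begin
    c (σ a)
      ≡⟨ sym (*-identityʳ (c (σ a))) ⟩
    c (σ a) * 1ℚ
      ≡⟨ cong (c (σ a) *_) (sym (trans (dual-δ B a a) (δ-refl a))) ⟩
    c (σ a) * dot (dual B a) (col M (σ a))
      ≡⟨ sym (Σ-single (σ a) off) ⟩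
    Σℚ (λ k → c k * dot (dual B a) (col M k))
      ≡⟨ dot-relation (dual B a) c (col M) rel ⟩
    0ℚ ∎
    where
    open ≡-Reasoning
    off : ∀ k → k ≢ σ a → c k * dot (dual B a) (col M k) ≡ 0ℚ
    off k k≢ with Image? σ k
    ... | no k∉          = *-zeroˡ-≡ (dot (dual B a) (col M k)) (outside k k∉)
    ... | yes (b , refl) = *-zeroʳ-≡ (c (σ b)) (trans (dual-δ B a b) (δ-≢ (λ a≡b → k≢ (cong σ (sym a≡b)))))

  Image-maximal : ∀ {σ} → ColBasis σ → ∀ i → ¬ Image σ i → ¬ IndepCols M (λ k → Image σ k ⊎ (k ≡ i))
  Image-maximal {σ} B i i∉ indep = 1≢0 (trans (sym at-i) (indep coeff outside relation i))
    where
    open ≡-Reasoning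
    t : Fin r → ℚ
    t a = dot (dual B a) (col M i)
    -- Column `i` minus its expansion in the basis; the inner sum carries the coordinates `t a` from
    -- positions `a` to columns `σ a`.
    coeff : Fin n → ℚ
    coeff k = δ i k - Σℚ (λ a → t a * δ (σ a) k)
    off-image : ∀ k → ¬ Image σ k → Σℚ (λ a → t a * δ (σ a) k) ≡ 0ℚ
    off-image k k∉ = Σ-zero (λ a → *-zeroʳ-≡ (t a) (δ-≢ (λ eq → k∉ (a , eq))))
    at-i : coeff i ≡ 1ℚ
    at-i = cong₂ _-_ (δ-refl i) (off-image i i∉)
    outside : ∀ k → ¬ (Image σ k ⊎ (k ≡ i)) → coeff k ≡ 0ℚ
    outside k k∉ = cong₂ _-_ (δ-≢ (λ eq → k∉ (inj₂ (sym eq)))) (off-image k (k∉ ∘ inj₁))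
    lemma₁ : ∀ d S x → (d - S) * x ≡ d * x - x * S
    lemma₁ = solve-∀ ℚ-ring
    lemma₂ : ∀ x t d → x * (t * d) ≡ t * (d * x)
    lemma₂ = solve-∀ ℚ-ring
    relation : ∀ c → Σℚ (λ k → coeff k * col M k c) ≡ 0ℚ
    relation c = begin
      Σℚ (λ k → coeff k * col M k c)
        ≡⟨ Σ-cong (λ k → lemma₁ (δ i k) (Σℚ (λ a → t a * δ (σ a) k)) (col M k c)) ⟩
      Σℚ (λ k → δ i k * col M k c - col M k c * Σℚ (λ a → t a * δ (σ a) k))
        ≡⟨ Σ-- (λ k → δ i k * col M k c) (λ k → col M k c * Σℚ (λ a → t a * δ (σ a) k)) ⟩
      Σℚ (λ k → δ i k * col M k c) - dot (λ k → col M k c) (λ k → Σℚ (λ a → t a * δ (σ a) k))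
        ≡⟨ cong₂ _-_ (Σ-δˡ i (λ k → col M k c)) (dot-Σʳ (λ k → col M k c) t (λ a → δ (σ a))) ⟩
      col M i c - Σℚ (λ a → t a * dot (λ k → col M k c) (δ (σ a)))
        ≡⟨ cong₂ _-_ (expand B (col M i) c) (Σ-cong (λ a → cong (t a *_)
             (trans (dot-comm (λ k → col M k c) (δ (σ a))) (Σ-δˡ (σ a) (λ k → col M k c))))) ⟩
      Σℚ (λ a → t a * col M (σ a) c) - Σℚ (λ a → t a * col M (σ a) c)
        ≡⟨ +-inverseʳ (Σℚ (λ a → t a * col M (σ a) c)) ⟩
      0ℚ ∎

  Image-basis : ∀ {σ} → ColBasis σ → IsBasis M (Image σ)
  Image-basis {σ} B = Image-indep {σ} B , Image-maximal {σ} B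

  -- A vector annihilating the support of γ would allow a basis inside the support to be enlarged.
  spanning⇒basis : ∀ {γ} → IsSpanning M γ → Σ (Fin r → Fin n) λ σ → (∀ a → γ (σ a) ≢ ℤ.+ 0) × ColBasis σ
  spanning⇒basis {γ} (S , (indep , maximal) , S⊆) with annihilated⊎basis (col M) (λ i → ¬? (γ i ℤ.≟ ℤ.+ 0))
  ... | inj₂ basis = basis
  ... | inj₁ (y , (e , ye≢0) , y⊥) with nonzero⊎zero (λ i → dot y (col M i))
  ...   | inj₂ y≡0         = ⊥-elim (ye≢0 (no-annihilator y y≡0 e))
  ...   | inj₁ (i , yMi≢0) = ⊥-elim (maximal i i∉S larger)
    where
    i∉S : ¬ S i
    i∉S Si = yMi≢0 (y⊥ i (S⊆ i Si))
    larger : IndepCols M (λ k → S k ⊎ (k ≡ i))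
    larger c outside rel = indep c outside′ rel
      where
      off : ∀ k → k ≢ i → c k * dot y (col M k) ≡ 0ℚ
      off k k≢i with γ k ℤ.≟ ℤ.+ 0
      ... | no γk≢0  = *-zeroʳ-≡ (c k) (y⊥ k γk≢0)
      ... | yes γk≡0 = *-zeroˡ-≡ (dot y (col M k)) (outside k λ where
                         (inj₁ Sk)  → S⊆ k Sk γk≡0
                         (inj₂ k≡i) → k≢i k≡i)
      ci≡0 : c i ≡ 0ℚ
      ci≡0 = *-cancelʳ-≡0 yMi≢0 (trans (sym (Σ-single i off)) (dot-relation y c (col M) rel))
      outside′ : ∀ k → ¬ S k → c k ≡ 0ℚ
      outside′ k k∉S with k Fin.≟ i
      ... | yes refl = ci≡0
      ... | no k≢i   = outside k λ where
                         (inj₁ Sk)  → k∉S Sk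
                         (inj₂ k≡i) → k≢i k≡i

-- Facets and spanning 2-cuts

module Facets {d n : ℕ} (M : Mat (suc d) n) (wu : IsFullRankWU M) (simple : IsSimple M) where

  open FullRankWU M wu
  open SimpleWU M wu simple
  open MatroidBases M wu

  private
    r′ = suc d

  spanning2cut⇒facet : ∀ {F} u → InPolar M u → IsSpanning2Cut M (transp· M u) → F ≐ Fu M u → IsFacet (PM M) F
  spanning2cut⇒facet {F} u polar ((_ , trit) , spanning) F≐Fu with spanning⇒basis spanning
  ... | σ , γσ≢0 , B = (U , 1ℚ , polar , F≐) , (p , (λ a → proj₂ (F≐ (p a)) (p∈P a , Up≡1 a)) , LinIndep⇒AffIndep {p = p} indep) ,
                       λ (q , q∈F , q-indep) → hyperplane-dim< U {q} (λ j → proj₂ (proj₁ (F≐ (q j)) (q∈F j))) q-indep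
    where
    open ≡-Reasoning
    U : Pt r′
    U = ι ∘ u
    F≐ : F ≐ (λ x → PM M x × (dot U x ≡ 1ℚ))
    F≐ x = (λ Fx → proj₁ (Fu-face u polar x) (proj₁ (F≐Fu x) Fx)) , (λ Px → proj₂ (F≐Fu x) (proj₂ (Fu-face u polar x) Px))
    s : Fin r′ → ℚ
    s a = ι (transp· M u (σ a))
    s-Unit : ∀ a → Unit (s a)
    s-Unit a = Trit∧≢0⇒Unit (Tritℤ⇒Trit (trit (σ a))) (λ eq → γσ≢0 a (ι-injective eq))
    -- Each column is signed by its own cut entry, so that `U` takes the value `s a * s a`, which is
    -- 1.
    p : Fin r′ → Pt r′
    p a c = s a * col M (σ a) c
    p∈P : ∀ a → PM M (p a)
    p∈P a = Conv-point {V = Generator} (σ a , sign (s-Unit a))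
      where
      sign : Unit (s a) → (p a ≈ col M (σ a)) ⊎ (p a ≈ (λ c → - col M (σ a) c))
      sign (inj₁ s≡1)  = inj₁ (λ c → trans (cong (_* col M (σ a) c) s≡1) (*-identityˡ (col M (σ a) c)))
      sign (inj₂ s≡-1) = inj₂ (λ c → trans (cong (_* col M (σ a) c) s≡-1)
                           (trans (sym (neg-distribˡ-* 1ℚ (col M (σ a) c))) (cong -_ (*-identityˡ (col M (σ a) c)))))
    Up≡1 : ∀ a → dot U (p a) ≡ 1ℚ
    Up≡1 a = begin
      dot U (p a)                  ≡⟨ dot-comm U (p a) ⟩
      dot (p a) U                  ≡⟨ dot-*ˡ (s a) (col M (σ a)) U ⟩
      s a * dot (col M (σ a)) U    ≡⟨ cong (s a *_) (trans (dot-comm (col M (σ a)) U) (transp·-dot M u (σ a))) ⟩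
      s a * s a                    ≡⟨ Unit-* (s-Unit a) ⟩
      1ℚ                           ∎
    indep : LinIndep p
    indep c rel a = *-cancelʳ-≡0 (Unit⇒≢0 (s-Unit a)) (Basis⇒LinIndep B (λ a → c a * s a)
      (λ e → trans (Σ-cong (λ a → *-assoc (c a) (s a) (col M (σ a) e))) (rel e)) a)

  origin∈PM : Fin n → PM M (λ _ → 0ℚ)
  origin∈PM i = 2 , (λ { zero → col M i ; (suc _) → λ a → - col M i a }) , (λ _ → ½) ,
    (λ { zero → i , inj₁ (λ _ → refl) ; (suc _) → i , inj₂ (λ _ → refl) }) , (λ _ → ≤ᵇ⇒≤ _) , refl ,
    λ a → sym (cancel (col M i a))
    where
    lemma : ∀ h m → h * m + (h * (- m) + 0ℚ) ≡ 0ℚ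
    lemma = solve-∀ ℚ-ring
    cancel : ∀ m → ½ * m + (½ * (- m) + 0ℚ) ≡ 0ℚ
    cancel = lemma ½

  module _ {c : Pt r′} {b : ℚ} (P≤b : ∀ x → PM M x → dot c x ≤ b) where

    private
      σ₀ = proj₁ (proj₁ wu)

      col≤ : ∀ i → dot c (col M i) ≤ b
      col≤ i = P≤b (col M i) (Conv-point {V = Generator} (i , inj₁ (λ _ → refl)))

      -col≤ : ∀ i → - dot c (col M i) ≤ b
      -col≤ i = subst (_≤ b) (dot-negʳ c (col M i))
        (P≤b (λ a → - col M i a) (Conv-point {V = Generator} (i , inj₂ (λ _ → refl))))

    valid⇒0≤b : 0ℚ ≤ b
    valid⇒0≤b = subst (_≤ b) (trans (dot-comm c (λ _ → 0ℚ)) (dot-zeroˡ c (λ _ → refl))) (P≤b (λ _ → 0ℚ) (origin∈PM (σ₀ zero)))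

    -- If b = 0 then c vanishes on the symmetric polytope, so the face is everything.
    facet⇒b≢0 : ∀ {F} → F ≐ (λ x → PM M x × (dot c x ≡ b)) → HasDim F d → b ≢ 0ℚ
    facet⇒b≢0 {F} F≐ (_ , no-more) refl = no-more (p , (λ j → proj₂ (F≐ (p j)) (p∈P j , Conv-≡ {V = Generator} c c⊥ (p∈P j))) , indep)
      where
      c⊥col : ∀ i → dot c (col M i) ≡ 0ℚ
      c⊥col i = ≤-antisym (col≤ i) (subst (0ℚ ≤_) (neg-involutive (dot c (col M i))) (neg-antimono-≤ (-col≤ i)))
      c⊥ : ∀ {v} → Generator v → dot c v ≡ 0ℚ
      c⊥ (i , inj₁ v≈) = trans (dot-cong {x = c} (λ _ → refl) v≈) (c⊥col i)
      c⊥ (i , inj₂ v≈) = trans (dot-cong {x = c} (λ _ → refl) v≈) (trans (dot-negʳ c (col M i)) (cong -_ (c⊥col i)))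
      -- The origin and `r` independent columns: `r + 1` affinely independent points, more than
      -- dimension `r - 1` allows.
      p : Fin (suc r′) → Pt r′
      p zero    = λ _ → 0ℚ
      p (suc j) = col M (σ₀ j)
      p∈P : ∀ j → PM M (p j)
      p∈P zero    = origin∈PM (σ₀ zero)
      p∈P (suc j) = Conv-point {V = Generator} (σ₀ j , inj₁ (λ _ → refl))
      indep : AffIndep p
      indep e rel = proj₂ (proj₁ wu) e (λ a → trans (Σ-cong (λ j → cong (e j *_) (sym (+-identityʳ (col M (σ₀ j) a))))) (rel a))

  facet⇒spanning2cut : ∀ {F} → IsFacet (PM M) F →
                       Σ (Fin r′ → ℤ) λ u → InPolar M u × (F ≐ Fu M u) × IsSpanning2Cut M (transp· M u)
  facet⇒spanning2cut {F} ((c , b , P≤b , F≐) , dim@((p , p∈F , p-indep) , _)) =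
    u , polar , F≐Fu , ((U , transp·-dot M u) , γ-Tritℤ) , Image σ , Image-basis {σ} B , support
    where
    open ≡-Reasoning
    b≢0 : b ≢ 0ℚ
    b≢0 = facet⇒b≢0 {c} P≤b F≐ dim
    0<b : 0ℚ < b
    0<b = ≤∧≢⇒< (valid⇒0≤b {c} P≤b) (b≢0 ∘ sym)
    q : ℚ
    q = proj₁ (inverse b≢0)
    qb≡1 : q * b ≡ 1ℚ
    qb≡1 = proj₂ (inverse b≢0)
    0≤q : 0ℚ ≤ q
    0≤q = *-cancelʳ-≤-pos b {{positive 0<b}} (subst₂ _≤_ (sym (*-zeroˡ b)) (sym qb≡1) (<⇒≤ 0<1))
    -- Dividing by `b` normalises the right-hand side to 1; only at this scale is the normal vector
    -- integral with values ±1 on a basis.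
    w : Pt r′
    w a = q * c a
    w·x≤1 : ∀ x → PM M x → dot w x ≤ 1ℚ
    w·x≤1 x Px = subst₂ _≤_ (sym (dot-*ˡ q c x)) qb≡1 (*-monoˡ-≤-nonNeg q {{nonNegative 0≤q}} (P≤b x Px))
    b⇒1 : ∀ x → dot c x ≡ b → dot w x ≡ 1ℚ
    b⇒1 x cx≡b = trans (dot-*ˡ q c x) (trans (cong (q *_) cx≡b) qb≡1)
    lemma : ∀ x q b → x * (q * b) ≡ b * (q * x)
    lemma = solve-∀ ℚ-ring
    1⇒b : ∀ x → dot w x ≡ 1ℚ → dot c x ≡ b
    1⇒b x wx≡1 = begin
      dot c x             ≡⟨ sym (*-identityʳ (dot c x)) ⟩
      dot c x * 1ℚ        ≡⟨ cong (dot c x *_) (sym qb≡1) ⟩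
      dot c x * (q * b)   ≡⟨ lemma (dot c x) q b ⟩
      b * (q * dot c x)   ≡⟨ cong (b *_) (trans (sym (dot-*ˡ q c x)) wx≡1) ⟩
      b * 1ℚ              ≡⟨ *-identityʳ b ⟩
      b                   ∎

    basis : Σ (Fin r′ → Fin n) λ σ → (∀ a → Unit (dot w (col M (σ a)))) × ColBasis σ
    basis with annihilated⊎basis (col M) (λ i → Unit? (dot w (col M i)))
    ... | inj₂ found = found
    -- A nonzero `y` annihilating all columns of value ±1 under `w` annihilates the generators on
    -- the face, hence the whole face, which however contains `r` linearly independent points.
    ... | inj₁ (y , (e , ye≢0) , y⊥) = ⊥-elim (ye≢0 (annihilator-zero {v = p} (AffIndep⇒LinIndep {p = p} w w·p≡1 p-indep) y y⊥p e))
      where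
      w·p≡1 : ∀ j → dot w (p j) ≡ 1ℚ
      w·p≡1 j = b⇒1 (p j) (proj₂ (proj₁ (F≐ (p j)) (p∈F j)))
      y⊥gen : ∀ {v} → Generator v × dot w v ≡ 1ℚ → dot y v ≡ 0ℚ
      y⊥gen {v} ((i , inj₁ v≈) , wv≡1) = trans (dot-cong {x = y} (λ _ → refl) v≈)
        (y⊥ i (inj₁ (trans (sym (dot-cong {x = w} (λ _ → refl) v≈)) wv≡1)))
      y⊥gen {v} ((i , inj₂ v≈) , wv≡1) = trans (dot-cong {x = y} (λ _ → refl) v≈) (trans (dot-negʳ y (col M i)) (cong -_
        (y⊥ i (inj₂ (trans (sym (neg-involutive (dot w (col M i))))
          (cong -_ (trans (sym (dot-negʳ w (col M i))) (trans (sym (dot-cong {x = w} (λ _ → refl) v≈)) wv≡1))))))))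
      y⊥p : ∀ j → dot y (p j) ≡ 0ℚ
      y⊥p j = Conv-≡ {V = λ v → Generator v × dot w v ≡ 1ℚ} y y⊥gen
        (Conv-face {V = Generator} w (λ {v} Gv → w·x≤1 v (Conv-point {V = Generator} Gv)) (proj₁ (proj₁ (F≐ (p j)) (p∈F j))) (w·p≡1 j))

    σ = proj₁ basis
    σ-Unit = proj₁ (proj₂ basis)
    B = proj₂ (proj₂ basis)

    -- The coefficients of `w` in the dual basis are its values on the basis columns, all ±1, and
    -- the dual vectors are integral.
    integral : ∀ e → IsInt (w e)
    integral e = subst IsInt (sym (Basis-expand-dual B w e))
      (IsInt-Σ (λ a → IsInt-* (IsInt-dual {σ} B a e) (Unit⇒Int (σ-Unit a))))
    u : Fin r′ → ℤ
    u e = proj₁ (integral e)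
    U : Pt r′
    U e = ι (u e)
    U≡w : ∀ x → dot U x ≡ dot w x
    U≡w x = dot-cong {y = x} (λ e → proj₂ (integral e)) (λ _ → refl)
    polar : InPolar M u
    polar x Px = subst (_≤ 1ℚ) (sym (U≡w x)) (w·x≤1 x Px)
    F≐Fu : F ≐ Fu M u
    F≐Fu x = (λ Fx → let Px , cx≡b = proj₁ (F≐ x) Fx in proj₂ (Fu-face u polar x) (Px , trans (U≡w x) (b⇒1 x cx≡b))) ,
             (λ Fux → let Px , Ux≡1 = proj₁ (Fu-face u polar x) Fux in proj₂ (F≐ x) (Px , 1⇒b x (trans (sym (U≡w x)) Ux≡1)))
    -- Polarity at a column and at its negative bounds the absolute value of the entry by 1.
    γ-Tritℤ : ∀ i → Tritℤ (transp· M u i)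
    γ-Tritℤ i = ∣z∣≤1⇒Tritℤ (transp· M u i)
      (subst (_≤ 1ℚ) (transp·-dot M u i) (polar (col M i) (Conv-point {V = Generator} (i , inj₁ (λ _ → refl)))))
      (subst (_≤ 1ℚ) (trans (dot-negʳ U (col M i)) (cong -_ (transp·-dot M u i)))
        (polar (λ a → - col M i a) (Conv-point {V = Generator} (i , inj₂ (λ _ → refl)))))
    support : ∀ i → Image σ i → transp· M u i ≢ ℤ.+ 0
    support _ (a , refl) eq = Unit⇒≢0 (σ-Unit a)
      (trans (sym (U≡w (col M (σ a)))) (trans (transp·-dot M u (σ a)) (cong ι eq)))

theorem5p8 : {r n : ℕ} (M : Mat r n) → 0 ℕ.< r → IsFullRankWU M → IsSimple M →
    (F : Pt r → Set) →
    (IsFacet (PM M) F →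
    Σ (Fin r → ℤ) (λ u → InPolar M u × (F ≐ Fu M u) × IsSpanning2Cut M (transp· M u)))
    × ((u : Fin r → ℤ) → InPolar M u → IsSpanning2Cut M (transp· M u) → F ≐ Fu M u →
    IsFacet (PM M) F)
-- Positivity excludes `zero`; matching on `suc d` makes the facet dimension `r ∸ 1` compute to `d`.
theorem5p8 {suc d} M _ wu simple F = facet⇒spanning2cut , spanning2cut⇒facet
  where open Facets M wu simple
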